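{- Let $n\ge5$ be an odd integer and let $$L=\begin{bmatrix}\frac{n-1}{2} & -\frac12\mathbf{e}' & \mathbf{0}'\\ -\frac12\mathbf{e} & A & B\\ \mathbf{0} & B & I_{n-1}\end{bmatrix},$$ where $A=\mathrm{Circ}(\mathbf{x}')$ and $B=\mathrm{Circ}(\mathbf{y}')$ are the circulant matrices of order $n-1$ defined in the context. Then the rank of $L$ is $2n-3$.
   Context: A prime denotes transpose; $\mathbf{e},\mathbf{0}\in\mathbb{R}^{n-1}$ are the all-ones and zero column vectors; $I_{n-1}$ is the identity matrix of order $n-1$. For $\mathbf{a}=(a_1,\dots,a_N)'\in\mathbb{R}^N$, $\mathrm{Circ}(\mathbf{a}')$ is the $N\times N$ circulant matrix with first row $(a_1,a_2,\dots,a_N)$, each subsequent row being the previous row cyclically shifted one place to the right. Vectors $\mathbf{x},\mathbf{y}$ (for odd $n\ge5$): put $m=\frac{n-1}{2}$ and, for $1\le k\le m$, $\alpha_k=(-1)^{k+1}\left[2m^2-6(m-k)^2+7\right]$. Then $$\mathbf{x}=\frac{1}{6(n-1)}(n^2+4n-12,\alpha_1,\alpha_2,\dots,\alpha_{m-1},\alpha_m,\alpha_{m-1},\dots,\alpha_2,\alpha_1)'\in\mathbb{R}^{n-1},$$ $$\mathbf{y}=\frac{1}{n-1}(2-n,-1,1,-1,1,\dots,-1,1,-1)'\in\mathbb{R}^{n-1}.$$ -}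

module Defs where

open import Algebra.Properties.Monoid.Sum using (sum)
open import Data.Bool.Base using (if_then_else_)
open import Data.Fin.Base using (toℕ)
open import Data.Fin.Properties using (_≟_)
open import Data.Integer.Base as ℤ using (ℤ; +_; -1ℤ)
open import Data.Nat.Base as ℕ using (ℕ; zero; suc; _∸_; _≤ᵇ_; NonZero; >-nonZero; z≤n; s≤s; ⌊_/2⌋)
open import Data.Nat.GeneralisedArithmetic using (iterate)
open import Data.Nat.Properties using (m*n≢0; m<n⇒0<n∸m; ≤-trans)
open import Data.Product.Base using (Σ-syntax; _×_)
open import Data.Rational.Base as ℚ using (ℚ; 0ℚ; 1ℚ; ½; _/_)
open import Data.Rational.Properties using (+-0-monoid)
open import Data.Vec.Functional using (Vector; _∷_; _++_; replicate; init; last; transpose)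
open import Function.Bundles using (_⇔_)
open import Level using (Level)
open import Relation.Binary.PropositionalEquality using (_≗_)
open import Relation.Nullary.Decidable using (does)

private
  variable
    a : Level
    A : Set a
    k m n r : ℕ

-- Matrices are vectors of rows.  Every matrix here has rational entries, and
-- the rank of a rational matrix is the same over ℚ and over ℝ.

Matrix : ℕ → ℕ → Set
Matrix m n = Vector (Vector ℚ n) m

combination : Vector ℚ k → Vector (Vector ℚ m) k → Vector ℚ m
combination c v i = sum +-0-monoid (λ j → c j ℚ.* v j i)

_∈Span_ : Vector ℚ m → Vector (Vector ℚ m) k → Set
_∈Span_ {k = k} u v = Σ[ c ∈ Vector ℚ k ] u ≗ combination c v

LinearlyIndependent : Vector (Vector ℚ m) k → Set
LinearlyIndependent {m = m} {k = k} v =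
  (c : Vector ℚ k) → combination c v ≗ replicate m 0ℚ → c ≗ replicate k 0ℚ

-- The column space of M has dimension r, i.e. it has a basis of r vectors.

HasRank : Matrix m n → ℕ → Set
HasRank {m = m} M r =
  Σ[ b ∈ Vector (Vector ℚ m) r ]
    LinearlyIndependent b × (∀ u → u ∈Span transpose M ⇔ u ∈Span b)

identity : (n : ℕ) → Matrix n n
identity n i j = if does (i ≟ j) then 1ℚ else 0ℚ

shiftRight : Vector A n → Vector A n
shiftRight {n = zero}  v = v
shiftRight {n = suc _} v = last v ∷ init v

Circ : Vector ℚ n → Matrix n n
Circ v i = iterate shiftRight v (toℕ i)

α : ℕ → ℕ → ℤ
α m k = -1ℤ ℤ.^ (k ℕ.+ 1) ℤ.*
        ((+ 2) ℤ.* (+ m) ℤ.^ 2 ℤ.- (+ 6) ℤ.* (+ m ℤ.- + k) ℤ.^ 2 ℤ.+ + 7)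

-- Positions count from 0.  For odd n, position k with m < k < n - 1 = 2m
-- carries α m (n - 1 - k), so those positions read α_{m-1}, …, α_1.

xNumerator : ℕ → ℕ → ℤ
xNumerator n zero      = (+ n) ℤ.^ 2 ℤ.+ (+ 4) ℤ.* (+ n) ℤ.- + 12
xNumerator n k@(suc _) =
  let m = ⌊ n ∸ 1 /2⌋ in
  if k ≤ᵇ m then α m k else α m (n ∸ 1 ∸ k)

yNumerator : ℕ → ℕ → ℤ
yNumerator n zero      = + 2 ℤ.- + n
yNumerator n k@(suc _) = -1ℤ ℤ.^ k

module _ (n : ℕ) (5≤n : 5 ℕ.≤ n) where

  private
    instance
      n-1≢0 : NonZero (n ∸ 1)
      n-1≢0 = >-nonZero (m<n⇒0<n∸m (≤-trans (s≤s (s≤s z≤n)) 5≤n))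

      6[n-1]≢0 : NonZero (6 ℕ.* (n ∸ 1))
      6[n-1]≢0 = m*n≢0 6 (n ∸ 1)

  x : Vector ℚ (n ∸ 1)
  x i = xNumerator n (toℕ i) / (6 ℕ.* (n ∸ 1))

  y : Vector ℚ (n ∸ 1)
  y i = yNumerator n (toℕ i) / (n ∸ 1)

  L : Matrix (1 ℕ.+ ((n ∸ 1) ℕ.+ (n ∸ 1))) (1 ℕ.+ ((n ∸ 1) ℕ.+ (n ∸ 1)))
  L = (+ (n ∸ 1) / 2 ∷ (replicate (n ∸ 1) (ℚ.- ½) ++ replicate (n ∸ 1) 0ℚ))
    ∷ ( (λ i → ℚ.- ½ ∷ (Circ x i ++ Circ y i))
     ++ (λ i → 0ℚ ∷ (Circ y i ++ identity (n ∸ 1) i)))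

{-# OPTIONS --safe #-}
module Submission where

-- Write N = n − 1, w = (1, −1, 1, …, −1)′ and S for the cyclic shift of order N.
-- Then B = −I + ww′/N, and A = I + Q where the first row of Q is an alternating
-- quadratic sequence X.  Second differences of a quadratic are constant, so
-- (S + 2 + S⁻¹) Q = 2I − 2ww′/N; summing the quadratic gives Q w = −w.
-- Hence every column (s, p, r) of L satisfies s + Σp + Σr = 0 and w·p = 0.
-- Conversely such a vector is L applied to (0, u, r + u), where
-- u = ½ (S + 2 + S⁻¹)(p + r).  So the column space is cut out by two independent
-- functionals, and its dimension is 2N + 1 − 2 = 2n − 3.

open import Defs

-- The vector (0, u, v) is found by elimination. Every row of `L` sums to zero, so the first
-- coefficient may be normalised to 0. If w·u = 0 then Bu = -u, and the last block forces v = r + u.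
-- With h = p + r, the middle block then reads Qu = h - w(w·h)/N, where w·h = w·r because w·p = 0.
-- On the complement of w the operator ½(S + 2 + S⁻¹) inverts Q, and it kills w; so u = ½(S + 2 +
-- S⁻¹)h solves this and w·u = 0 comes for free. The entries of u sum to 2Σh, so the border -½
-- yields s = -Σh. Since S + 2 + S⁻¹ annihilates w, the second-difference identity says nothing
-- about the w-component of Q. That is why Qw = -w needs an explicit summation. No product of
-- circulants is ever formed: the operator is self-adjoint and is moved across dot products instead.

module BorderedCirculant where
  open import Algebra.Bundles using (CommutativeRing)
  open import Data.Bool.Base using (true; false; if_then_else_)
  open import Data.Fin.Base using (Fin; zero; suc; toℕ; fromℕ; inject₁; splitAt; _↑ˡ_; _↑ʳ_)
  import Data.Fin.Properties as Finₚ
  open Finₚ using (join-splitAt; toℕ-fromℕ; toℕ-inject₁; toℕ<n)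
  open import Data.Fin.Permutation using (permutation)
  open import Data.Integer.Base as ℤ using (ℤ; +_; -1ℤ; 1ℤ)
  import Data.Integer.Properties as ℤₚ
  open import Data.Nat.Base as ℕ using (ℕ; zero; suc; NonZero; ⌊_/2⌋; s≤s; _≤_; _∸_)
  open import Data.Nat.GeneralisedArithmetic using (iterate)
  import Data.Nat.Properties as ℕₚ
  open import Data.Product.Base using (_,_; ∃-syntax)
  open import Data.Rational.Base
    using (ℚ; 0ℚ; 1ℚ; ½; _/_; _+_; _*_; _-_; -_; fromℚᵘ)
  open import Data.Rational.Properties
    using (+-*-commutativeRing; _≟_; /-cong; +-assoc; +-identityˡ; +-identityʳ; *-comm; *-identityˡ;
           *-identityʳ; *-zeroˡ; *-zeroʳ; toℚᵘ-injective; toℚᵘ-homo-+; toℚᵘ-homo-*; toℚᵘ-homo‿-;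
           toℚᵘ-fromℚᵘ; fromℚᵘ-cong)
  import Data.Rational.Unnormalised.Base as ℚᵘ
  open ℚᵘ using (mkℚᵘ)
  import Data.Rational.Unnormalised.Properties as ℚᵘₚ
  open import Data.Sum.Base using (_⊎_; inj₁; inj₂)
  open import Data.Vec.Functional using (Vector; _∷_; _++_; replicate; transpose)
  open import Data.Vec.Functional.Properties using (lookup-++ˡ; lookup-++ʳ)
  open import Function.Base using (_∘_)
  open import Function.Bundles using (mk⇔)
  open import Relation.Binary.PropositionalEquality
  open import Relation.Nullary.Decidable using (yes; no)
  open import Relation.Nullary.Decidable.Core using (dec⇒maybe)
  open import Relation.Nullary.Negation using (contradiction)
  open import Tactic.RingSolver using (solve-∀)
  open import Tactic.RingSolver.Core.AlmostCommutativeRing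
    using (AlmostCommutativeRing; fromCommutativeRing)
  open import Algebra.Properties.Semiring.Sum (CommutativeRing.semiring +-*-commutativeRing)
  open ≡-Reasoning

  private variable
    m n k : ℕ

  -- Integers and fractions inside ℚ.

  ℚ-ring : AlmostCommutativeRing _ _
  ℚ-ring = fromCommutativeRing +-*-commutativeRing (λ p → dec⇒maybe (0ℚ ≟ p))

  -- Since `z / suc d` is `fromℚᵘ (mkℚᵘ z d)`, these laws replace gcd-normalised arithmetic by
  -- cross-multiplication.
  fromℚᵘ-homo-+ : ∀ p q → fromℚᵘ (p ℚᵘ.+ q) ≡ fromℚᵘ p + fromℚᵘ q
  fromℚᵘ-homo-+ p q = toℚᵘ-injective (ℚᵘₚ.≃-trans (toℚᵘ-fromℚᵘ (p ℚᵘ.+ q))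
    (ℚᵘₚ.≃-sym (ℚᵘₚ.≃-trans (toℚᵘ-homo-+ (fromℚᵘ p) (fromℚᵘ q))
      (ℚᵘₚ.+-cong (toℚᵘ-fromℚᵘ p) (toℚᵘ-fromℚᵘ q)))))

  fromℚᵘ-homo-* : ∀ p q → fromℚᵘ (p ℚᵘ.* q) ≡ fromℚᵘ p * fromℚᵘ q
  fromℚᵘ-homo-* p q = toℚᵘ-injective (ℚᵘₚ.≃-trans (toℚᵘ-fromℚᵘ (p ℚᵘ.* q))
    (ℚᵘₚ.≃-sym (ℚᵘₚ.≃-trans (toℚᵘ-homo-* (fromℚᵘ p) (fromℚᵘ q))
      (ℚᵘₚ.*-cong (toℚᵘ-fromℚᵘ p) (toℚᵘ-fromℚᵘ q)))))

  fromℚᵘ-homo-- : ∀ p → fromℚᵘ (ℚᵘ.- p) ≡ - fromℚᵘ p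
  fromℚᵘ-homo-- p = toℚᵘ-injective (ℚᵘₚ.≃-trans (toℚᵘ-fromℚᵘ (ℚᵘ.- p))
    (ℚᵘₚ.≃-sym (ℚᵘₚ.≃-trans (toℚᵘ-homo‿- (fromℚᵘ p)) (ℚᵘₚ.-‿cong (toℚᵘ-fromℚᵘ p)))))

  fromℤ : ℤ → ℚ
  fromℤ z = z / 1

  fromℤ-+ : ∀ a b → fromℤ (a ℤ.+ b) ≡ fromℤ a + fromℤ b
  fromℤ-+ a b = trans
    (cong fromℤ (sym (cong₂ ℤ._+_ (ℤₚ.*-identityʳ a) (ℤₚ.*-identityʳ b))))
    (fromℚᵘ-homo-+ (mkℚᵘ a 0) (mkℚᵘ b 0))

  fromℤ-* : ∀ a b → fromℤ (a ℤ.* b) ≡ fromℤ a * fromℤ b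
  fromℤ-* a b = fromℚᵘ-homo-* (mkℚᵘ a 0) (mkℚᵘ b 0)

  fromℤ-neg : ∀ a → fromℤ (ℤ.- a) ≡ - fromℤ a
  fromℤ-neg a = fromℚᵘ-homo-- (mkℚᵘ a 0)

  -- Splits a quotient into a numerator and a reciprocal that the ring solver can treat as an
  -- indeterminate.
  /-as-* : ∀ z d .{{_ : NonZero d}} → z / d ≡ fromℤ z * (1ℤ / d)
  /-as-* z (suc d) = trans
    (/-cong (sym (ℤₚ.*-identityʳ z)) (sym (ℕₚ.+-identityʳ (suc d))))
    (fromℚᵘ-homo-* (mkℚᵘ z 0) (mkℚᵘ 1ℤ d))

  1/n*n≡1 : ∀ d .{{_ : NonZero d}} → (1ℤ / d) * fromℤ (+ d) ≡ 1ℚ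
  1/n*n≡1 (suc d) = trans (sym (fromℚᵘ-homo-* (mkℚᵘ 1ℤ d) (mkℚᵘ (+ suc d) 0)))
    (fromℚᵘ-cong {ℚᵘ.1/ p ℚᵘ.* p} {ℚᵘ.1ℚᵘ} (ℚᵘₚ.*-inverseˡ p))
    where p = mkℚᵘ (+ suc d) 0

  -- Finite sums and dot products.

  ∑-zero : (f : Vector ℚ n) → (∀ i → f i ≡ 0ℚ) → sum f ≡ 0ℚ
  ∑-zero {n} f f≡0 = trans (sum-cong-≗ f≡0) (sum-replicate-zero n)

  ∑-++ : (f : Vector ℚ (m ℕ.+ n)) → sum f ≡ sum (λ i → f (i ↑ˡ n)) + sum (λ i → f (m ↑ʳ i))
  ∑-++ {zero}  f = sym (+-identityˡ _)
  ∑-++ {suc m} f = trans (cong (λ t → f zero + t) (∑-++ {m} (f ∘ suc))) (sym (+-assoc (f zero) _ _))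

  ↑-cases : (P : Fin (m ℕ.+ n) → Set) → (∀ i → P (i ↑ˡ n)) → (∀ i → P (m ↑ʳ i)) → ∀ i → P i
  ↑-cases {m} {n} P l r i with splitAt m i | join-splitAt m n i
  ... | inj₁ j | refl = l j
  ... | inj₂ j | refl = r j

  infix 8 _·_
  _·_ : Vector ℚ n → Vector ℚ n → ℚ
  u · v = sum (λ i → u i * v i)

  ·-cong : {u u′ v v′ : Vector ℚ n} → u ≗ u′ → v ≗ v′ → u · v ≡ u′ · v′
  ·-cong p q = sum-cong-≗ (λ i → cong₂ _*_ (p i) (q i))

  ·-comm : (u v : Vector ℚ n) → u · v ≡ v · u
  ·-comm u v = sum-cong-≗ (λ i → *-comm (u i) (v i))

  ·-distribˡ : (u v w : Vector ℚ n) → u · (λ i → v i + w i) ≡ u · v + u · w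
  ·-distribˡ u v w = trans (sum-cong-≗ (λ i → ring (u i) (v i) (w i))) (∑-distrib-+ (λ i → u i * v i) (λ i → u i * w i))
    where
    ring : ∀ a b c → a * (b + c) ≡ a * b + a * c
    ring = solve-∀ ℚ-ring

  ·-scaleˡ : ∀ a (u v : Vector ℚ n) → u · (λ i → a * v i) ≡ a * (u · v)
  ·-scaleˡ a u v = trans (sum-cong-≗ (λ i → ring a (u i) (v i))) (sym (*-distribˡ-sum a (λ i → u i * v i)))
    where
    ring : ∀ a b c → b * (a * c) ≡ a * (b * c)
    ring = solve-∀ ℚ-ring

  identity-suc : (i j : Fin n) → identity (suc n) (suc i) (suc j) ≡ identity n i j
  identity-suc i j with i Finₚ.≟ j
  ... | yes _ = refl
  ... | no _ = refl

  ·-identityʳ : (u : Vector ℚ n) (i : Fin n) → u · identity n i ≡ u i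
  ·-identityʳ u zero = begin
    u zero * 1ℚ + sum (λ j → u (suc j) * 0ℚ)
      ≡⟨ cong₂ _+_ (*-identityʳ (u zero)) (∑-zero _ (λ j → *-zeroʳ (u (suc j)))) ⟩
    u zero + 0ℚ                              ≡⟨ +-identityʳ (u zero) ⟩
    u zero                                   ∎
  ·-identityʳ u (suc i) = begin
    u zero * 0ℚ + sum (λ j → u (suc j) * identity _ (suc i) (suc j))
      ≡⟨ cong₂ _+_ (*-zeroʳ (u zero)) (·-cong {u = u ∘ suc} (λ _ → refl) (identity-suc i)) ⟩
    0ℚ + (u ∘ suc) · identity _ i ≡⟨ +-identityˡ _ ⟩
    (u ∘ suc) · identity _ i      ≡⟨ ·-identityʳ (u ∘ suc) i ⟩
    u (suc i)                     ∎

  identity-sym : (i j : Fin n) → identity n i j ≡ identity n j i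
  identity-sym i j with i Finₚ.≟ j | j Finₚ.≟ i
  ... | yes _    | yes _    = refl
  ... | no _     | no _     = refl
  ... | yes refl | no i≢i   with () ← i≢i refl
  ... | no i≢i   | yes refl with () ← i≢i refl

  -- Spans, functionals and rank.

  ·-combination : (φ : Vector ℚ m) (c : Vector ℚ k) (v : Vector (Vector ℚ m) k) →
                  φ · combination c v ≡ c · (λ j → φ · v j)
  ·-combination φ c v = begin
    sum (λ i → φ i * sum (λ j → c j * v j i))
      ≡⟨ sum-cong-≗ (λ i → *-distribˡ-sum (φ i) (λ j → c j * v j i)) ⟩
    sum (λ i → sum (λ j → φ i * (c j * v j i))) ≡⟨ ∑-comm (λ i j → φ i * (c j * v j i)) ⟩
    sum (λ j → sum (λ i → φ i * (c j * v j i))) ≡⟨ sum-cong-≗ (λ j → ·-scaleˡ (c j) φ (v j)) ⟩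
    c · (λ j → φ · v j)                         ∎

  Span-·≡0 : (φ : Vector ℚ m) {v : Vector (Vector ℚ m) k} {u : Vector ℚ m} →
             (∀ j → φ · v j ≡ 0ℚ) → u ∈Span v → φ · u ≡ 0ℚ
  Span-·≡0 φ {v} {u} φ·v≡0 (c , u≗) = begin
    φ · u                 ≡⟨ ·-cong {u = φ} (λ _ → refl) u≗ ⟩
    φ · combination c v   ≡⟨ ·-combination φ c v ⟩
    c · (λ j → φ · v j)   ≡⟨ ∑-zero _ (λ j → trans (cong (c j *_) (φ·v≡0 j)) (*-zeroʳ (c j))) ⟩
    0ℚ                    ∎

  -- A subspace cut out by two independent functionals in echelon form is a graph
  -- over the remaining r coordinates, which supply its basis.
  hasRank-echelon :
    ∀ {r} (M : Matrix (2 ℕ.+ r) k) (φ ψ : Vector ℚ (2 ℕ.+ r)) →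
    φ zero ≡ 1ℚ → ψ zero ≡ 0ℚ → ψ (suc zero) ≡ 1ℚ →
    (∀ j → φ · transpose M j ≡ 0ℚ) → (∀ j → ψ · transpose M j ≡ 0ℚ) →
    (∀ u → φ · u ≡ 0ℚ → ψ · u ≡ 0ℚ → u ∈Span transpose M) →
    HasRank M r
  hasRank-echelon {r = r} M φ ψ φ₀≡1 ψ₀≡0 ψ₁≡1 φ·M≡0 ψ·M≡0 solve-M =
    -- Both spans are the common kernel of `φ` and `ψ`, and each direction of the equivalence passes
    -- through it.
    basis , independent , λ u → mk⇔
      (λ u∈M → span-basis u (Span-·≡0 φ φ·M≡0 u∈M) (Span-·≡0 ψ ψ·M≡0 u∈M))
      (λ u∈b → solve-M u (Span-·≡0 φ φ·basis≡0 u∈b) (Span-·≡0 ψ ψ·basis≡0 u∈b))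
    where
    φ₁ = φ (suc zero)
    φ″ ψ″ : Vector ℚ r
    φ″ i = φ (suc (suc i))
    ψ″ i = ψ (suc (suc i))

    basis : Vector (Vector ℚ (2 ℕ.+ r)) r
    -- With the k-th free coordinate 1 and the others 0, `ψ` forces `- ψ″ k` in the second place,
    -- and then `φ` forces the first.
    basis k = (φ₁ * ψ″ k - φ″ k) ∷ (- ψ″ k) ∷ identity r k

    -- The identity block lets the coefficients be read off the free coordinates; this gives
    -- independence and also the last case of spanning.
    combination-tail : ∀ c i → combination c basis (suc (suc i)) ≡ c i
    combination-tail c i = trans (·-cong {u = c} (λ _ → refl) (λ k → identity-sym k i)) (·-identityʳ c i)

    independent : LinearlyIndependent basis
    independent c c≗0 i = trans (sym (combination-tail c i)) (c≗0 (suc (suc i)))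

    φ·basis≡0 : ∀ k → φ · basis k ≡ 0ℚ
    φ·basis≡0 k = begin
      φ · basis k ≡⟨ cong₂ (λ s t → s * (φ₁ * ψ″ k - φ″ k) + (φ₁ * - ψ″ k + t)) φ₀≡1 (·-identityʳ φ″ k) ⟩
      1ℚ * (φ₁ * ψ″ k - φ″ k) + (φ₁ * - ψ″ k + φ″ k) ≡⟨ ring φ₁ (ψ″ k) (φ″ k) ⟩
      0ℚ ∎
      where
      ring : ∀ a b c → 1ℚ * (a * b - c) + (a * - b + c) ≡ 0ℚ
      ring = solve-∀ ℚ-ring

    ψ·basis≡0 : ∀ k → ψ · basis k ≡ 0ℚ
    ψ·basis≡0 k = begin
      ψ · basis k
        ≡⟨ cong₂ (λ s t → s * (φ₁ * ψ″ k - φ″ k) + t) ψ₀≡0 (cong₂ (λ s t → s * - ψ″ k + t) ψ₁≡1 (·-identityʳ ψ″ k)) ⟩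
      0ℚ * (φ₁ * ψ″ k - φ″ k) + (1ℚ * - ψ″ k + ψ″ k) ≡⟨ ring (φ₁ * ψ″ k - φ″ k) (ψ″ k) ⟩
      0ℚ ∎
      where
      ring : ∀ a b → 0ℚ * a + (1ℚ * - b + b) ≡ 0ℚ
      ring = solve-∀ ℚ-ring

    span-basis : ∀ u → φ · u ≡ 0ℚ → ψ · u ≡ 0ℚ → u ∈Span basis
    span-basis u φ·u≡0 ψ·u≡0 = u″ , eq
      where
      u″ : Vector ℚ r
      u″ i = u (suc (suc i))

      u₁≡ : u (suc zero) ≡ - (ψ″ · u″)
      u₁≡ = begin
        u (suc zero) ≡⟨ ring (u zero) (u (suc zero)) (ψ″ · u″) ⟩
        (0ℚ * u zero + (1ℚ * u (suc zero) + ψ″ · u″)) - ψ″ · u″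
          ≡⟨ cong (_- ψ″ · u″) (trans (cong₂ (λ s t → s * u zero + (t * u (suc zero) + ψ″ · u″)) (sym ψ₀≡0) (sym ψ₁≡1)) ψ·u≡0) ⟩
        0ℚ - ψ″ · u″ ≡⟨ +-identityˡ _ ⟩
        - (ψ″ · u″) ∎
        where
        ring : ∀ a b c → b ≡ (0ℚ * a + (1ℚ * b + c)) - c
        ring = solve-∀ ℚ-ring

      u₀≡ : u zero ≡ φ₁ * (ψ″ · u″) - φ″ · u″
      u₀≡ = begin
        u zero ≡⟨ ring (u zero) φ₁ (u (suc zero)) (φ″ · u″) ⟩
        (1ℚ * u zero + (φ₁ * u (suc zero) + φ″ · u″)) - φ₁ * u (suc zero) - φ″ · u″
          ≡⟨ cong₂ (λ s t → s - φ₁ * t - φ″ · u″) (trans (cong (λ s → s * u zero + (φ₁ * u (suc zero) + φ″ · u″)) (sym φ₀≡1)) φ·u≡0) u₁≡ ⟩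
        0ℚ - φ₁ * - (ψ″ · u″) - φ″ · u″ ≡⟨ ring′ φ₁ (ψ″ · u″) (φ″ · u″) ⟩
        φ₁ * (ψ″ · u″) - φ″ · u″ ∎
        where
        ring : ∀ a b c d → a ≡ (1ℚ * a + (b * c + d)) - b * c - d
        ring = solve-∀ ℚ-ring
        ring′ : ∀ a b c → 0ℚ - a * - b - c ≡ a * b - c
        ring′ = solve-∀ ℚ-ring

      eq : u ≗ combination u″ basis
      eq zero = trans u₀≡ (sym (begin
        u″ · (λ k → φ₁ * ψ″ k - φ″ k) ≡⟨ sum-cong-≗ (λ k → ring φ₁ (u″ k) (ψ″ k) (φ″ k)) ⟩
        u″ · (λ k → φ₁ * ψ″ k + (- 1ℚ) * φ″ k)
          ≡⟨ ·-distribˡ u″ _ _ ⟩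
        u″ · (λ k → φ₁ * ψ″ k) + u″ · (λ k → (- 1ℚ) * φ″ k)
          ≡⟨ cong₂ _+_ (·-scaleˡ φ₁ u″ ψ″) (·-scaleˡ (- 1ℚ) u″ φ″) ⟩
        φ₁ * (u″ · ψ″) + (- 1ℚ) * (u″ · φ″)
          ≡⟨ cong₂ (λ s t → φ₁ * s + (- 1ℚ) * t) (·-comm u″ ψ″) (·-comm u″ φ″) ⟩
        φ₁ * (ψ″ · u″) + (- 1ℚ) * (φ″ · u″)
          ≡⟨ ring′ φ₁ (ψ″ · u″) (φ″ · u″) ⟩
        φ₁ * (ψ″ · u″) - φ″ · u″ ∎))
        where
        ring : ∀ a b c d → b * (a * c - d) ≡ b * (a * c + (- 1ℚ) * d)
        ring = solve-∀ ℚ-ring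
        ring′ : ∀ a b c → a * b + (- 1ℚ) * c ≡ a * b - c
        ring′ = solve-∀ ℚ-ring
      eq (suc zero) = trans u₁≡ (sym (begin
        u″ · (λ k → - ψ″ k) ≡⟨ sum-cong-≗ (λ k → ring (u″ k) (ψ″ k)) ⟩
        sum (λ k → (- 1ℚ) * (ψ″ k * u″ k)) ≡⟨ sym (*-distribˡ-sum (- 1ℚ) (λ k → ψ″ k * u″ k)) ⟩
        (- 1ℚ) * (ψ″ · u″) ≡⟨ ring′ (ψ″ · u″) ⟩
        - (ψ″ · u″) ∎))
        where
        ring : ∀ a b → a * - b ≡ (- 1ℚ) * (b * a)
        ring = solve-∀ ℚ-ring
        ring′ : ∀ a → (- 1ℚ) * a ≡ - a
        ring′ = solve-∀ ℚ-ring
      eq (suc (suc i)) = sym (combination-tail u″ i)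

  -- Cyclic index arithmetic.

  module _ {A : Set} where
    iterate-commute : (f g : A → A) → (∀ a → f (g a) ≡ g (f a)) →
                      ∀ k a → iterate f (g a) k ≡ g (iterate f a k)
    iterate-commute f g fg zero    a = refl
    iterate-commute f g fg (suc k) a =
      trans (cong (λ b → iterate f b k) (fg a)) (iterate-commute f g fg k (f a))

    iterate-∘ : (f : A → A) → ∀ k a → iterate f (f a) k ≡ f (iterate f a k)
    iterate-∘ f = iterate-commute f f (λ _ → refl)

    -- Plays the role of the commutative law for residues, with no group structure on `Fin` set up:
    -- every index shift below is an iterate of `pred`.
    iterate-comm : (f : A → A) → ∀ k l a → iterate f (iterate f a l) k ≡ iterate f (iterate f a k) l
    iterate-comm f k zero    a = refl
    iterate-comm f k (suc l) a =
      trans (iterate-comm f k l (f a)) (cong (λ b → iterate f b l) (iterate-∘ f k a))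

  pred : Fin (suc n) → Fin (suc n)
  pred zero    = fromℕ _
  pred (suc i) = inject₁ i

  pred-injective : {i j : Fin (suc n)} → pred i ≡ pred j → i ≡ j
  pred-injective {i = zero}  {zero}  _  = refl
  pred-injective {i = zero}  {suc j} eq = contradiction eq Finₚ.fromℕ≢inject₁
  pred-injective {i = suc i} {zero}  eq = contradiction (sym eq) Finₚ.fromℕ≢inject₁
  pred-injective {i = suc i} {suc j} eq = cong suc (Finₚ.inject₁-injective eq)

  infixl 6 _⊖_
  -- Subtraction modulo `suc n`, encoded by iteration to match the iterated `shiftRight` in `Circ`.
  _⊖_ : Fin (suc n) → Fin (suc n) → Fin (suc n)
  j ⊖ i = iterate pred j (toℕ i)

  iterate-pred-injective : ∀ k {i j : Fin (suc n)} → iterate pred i k ≡ iterate pred j k → i ≡ j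
  iterate-pred-injective zero    eq = eq
  iterate-pred-injective (suc k) eq = pred-injective (iterate-pred-injective k eq)

  iterate-pred-toℕ : ∀ k (i : Fin (suc n)) → toℕ i ≡ k → iterate pred i k ≡ zero
  iterate-pred-toℕ zero    zero    _  = refl
  iterate-pred-toℕ (suc k) (suc i) eq =
    iterate-pred-toℕ k (inject₁ i) (trans (toℕ-inject₁ i) (cong ℕ.pred eq))

  ⊖-self : (i : Fin (suc n)) → i ⊖ i ≡ zero
  ⊖-self i = iterate-pred-toℕ (toℕ i) i refl

  -- Iterates of `pred` are injective and `i ⊖ i` is `zero`. Equalities of indices are proved
  -- through this by subtracting one side.
  ⊖-zero : (i j : Fin (suc n)) → j ⊖ i ≡ zero → j ≡ i
  ⊖-zero i j eq = iterate-pred-injective (toℕ i) (trans eq (sym (⊖-self i)))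

  -- The two subtractions commute, leaving `d ⊖ d`. As an involution, `j ⊖_` is a permutation along
  -- which a column of a circulant can be summed.
  ⊖-involutive : (j i : Fin (suc n)) → j ⊖ (j ⊖ i) ≡ i
  ⊖-involutive j i = ⊖-zero i (j ⊖ d) (begin
    (j ⊖ d) ⊖ i ≡⟨ iterate-comm pred (toℕ i) (toℕ d) j ⟩
    (j ⊖ i) ⊖ d ≡⟨ ⊖-self d ⟩
    zero        ∎)
    where d = j ⊖ i

  -- n steps back around a cycle of length suc n are one step forward.
  succ : Fin (suc n) → Fin (suc n)
  succ {n} i = iterate pred i n

  -- Subtracting `i` moves the claim to index `zero`, whose predecessor is the last index, exactly
  -- `n` steps above `zero`.
  succ-pred : (i : Fin (suc n)) → succ (pred i) ≡ i
  succ-pred {n} i = ⊖-zero i (succ (pred i)) (begin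
    succ (pred i) ⊖ i                   ≡⟨ iterate-comm pred (toℕ i) n (pred i) ⟩
    succ (iterate pred (pred i) (toℕ i)) ≡⟨ cong succ (iterate-∘ pred (toℕ i) i) ⟩
    succ (pred (i ⊖ i))                 ≡⟨ cong (succ ∘ pred) (⊖-self i) ⟩
    succ (fromℕ n)                      ≡⟨ iterate-pred-toℕ n (fromℕ n) (toℕ-fromℕ n) ⟩
    zero                                ∎)

  pred-succ : (i : Fin (suc n)) → pred (succ i) ≡ i
  pred-succ {n} i = trans (sym (iterate-∘ pred n i)) (succ-pred i)

  sum-pred : (f : Vector ℚ (suc n)) → sum (f ∘ pred) ≡ sum f
  sum-pred f = sym (sum-permute f (permutation pred succ pred-succ succ-pred))

  sum-⊖ : (f : Vector ℚ (suc n)) (j : Fin (suc n)) → sum (λ i → f (j ⊖ i)) ≡ sum f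
  sum-⊖ f j = sym (sum-permute f (permutation (j ⊖_) (j ⊖_) (⊖-involutive j) (⊖-involutive j)))

  -- Circulant matrices and the self-adjoint shift operator.

  iterate-shiftRight : {A : Set} (v : Vector A (suc n)) → ∀ k j →
                       iterate shiftRight v k j ≡ v (iterate pred j k)
  iterate-shiftRight v zero    j = refl
  iterate-shiftRight v (suc k) j = begin
    iterate shiftRight (shiftRight v) k j ≡⟨ iterate-shiftRight (shiftRight v) k j ⟩
    shiftRight v (iterate pred j k)       ≡⟨ shiftRight-pred (iterate pred j k) ⟩
    v (pred (iterate pred j k))           ≡⟨ cong v (iterate-∘ pred k j) ⟨
    v (iterate pred (pred j) k)           ∎
    where
    shiftRight-pred : ∀ i → shiftRight v i ≡ v (pred i)
    shiftRight-pred zero    = refl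
    shiftRight-pred (suc i) = refl

  Circ-⊖ : (v : Vector ℚ (suc n)) → ∀ i j → Circ v i j ≡ v (j ⊖ i)
  Circ-⊖ v i = iterate-shiftRight v (toℕ i)

  -- Turns the unit-vector part of a generating row into the identity part of its circulant.
  identity-⊖ : (i j : Fin (suc n)) → identity (suc n) zero (j ⊖ i) ≡ identity (suc n) i j
  identity-⊖ i j with i Finₚ.≟ j
  ... | yes refl rewrite ⊖-self i = refl
  ... | no i≢j with j ⊖ i in eq
  ...   | zero  = contradiction (sym (⊖-zero i j eq)) i≢j
  ...   | suc _ = refl

  -- The operator S + 2 + S⁻¹.
  neighbours : Vector ℚ (suc n) → Vector ℚ (suc n)
  neighbours f j = f (pred j) + (f j + f j) + f (succ j)

  -- Reindexing makes S on one factor into S⁻¹ on the other, and the operator contains both with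
  -- equal weight.
  ·-neighbours : (u v : Vector ℚ (suc n)) → u · neighbours v ≡ neighbours u · v
  ·-neighbours u v = begin
    u · neighbours v
      ≡⟨ trans (·-distribˡ u (λ j → v (pred j) + (v j + v j)) (v ∘ succ))
               (cong (_+ u · (v ∘ succ)) (·-distribˡ u (v ∘ pred) (λ j → v j + v j))) ⟩
    u · (v ∘ pred) + u · (λ j → v j + v j) + u · (v ∘ succ)
      ≡⟨ cong₂ (λ s t → s + u · (λ j → v j + v j) + t) shift-pred shift-succ ⟩
    v · (u ∘ succ) + u · (λ j → v j + v j) + v · (u ∘ pred)
      ≡⟨ cong (λ s → v · (u ∘ succ) + s + v · (u ∘ pred)) (sum-cong-≗ (λ j → ring (u j) (v j))) ⟩
    v · (u ∘ succ) + v · (λ j → u j + u j) + v · (u ∘ pred)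
      ≡⟨ ring′ (v · (u ∘ succ)) (v · (λ j → u j + u j)) (v · (u ∘ pred)) ⟩
    v · (u ∘ pred) + v · (λ j → u j + u j) + v · (u ∘ succ)
      ≡⟨ trans (·-distribˡ v (λ j → u (pred j) + (u j + u j)) (u ∘ succ))
               (cong (_+ v · (u ∘ succ)) (·-distribˡ v (u ∘ pred) (λ j → u j + u j))) ⟨
    v · neighbours u ≡⟨ ·-comm v (neighbours u) ⟩
    neighbours u · v ∎
    where
    ring : ∀ a b → a * (b + b) ≡ b * (a + a)
    ring = solve-∀ ℚ-ring
    ring′ : ∀ a b c → a + b + c ≡ c + b + a
    ring′ = solve-∀ ℚ-ring

    shift-succ : u · (v ∘ succ) ≡ v · (u ∘ pred)
    shift-succ = begin
      u · (v ∘ succ)          ≡⟨ sum-pred (λ j → u j * v (succ j)) ⟨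
      (u ∘ pred) · (v ∘ succ ∘ pred) ≡⟨ ·-cong {u = u ∘ pred} (λ _ → refl) (λ j → cong v (succ-pred j)) ⟩
      (u ∘ pred) · v          ≡⟨ ·-comm (u ∘ pred) v ⟩
      v · (u ∘ pred)          ∎

    shift-pred : u · (v ∘ pred) ≡ v · (u ∘ succ)
    shift-pred = begin
      u · (v ∘ pred)                 ≡⟨ ·-cong {v = v ∘ pred} (λ j → cong u (succ-pred j)) (λ _ → refl) ⟨
      (u ∘ succ ∘ pred) · (v ∘ pred) ≡⟨ sum-pred (λ j → u (succ j) * v j) ⟩
      (u ∘ succ) · v                 ≡⟨ ·-comm (u ∘ succ) v ⟩
      v · (u ∘ succ)                 ∎

  neighbours-⊖ : (f : Vector ℚ (suc n)) → ∀ i j → neighbours (λ k → f (k ⊖ i)) j ≡ neighbours f (j ⊖ i)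
  neighbours-⊖ {n} f i j =
    cong₂ (λ s t → s + (f (j ⊖ i) + f (j ⊖ i)) + t)
      (cong f (iterate-∘ pred (toℕ i) j)) (cong f (iterate-comm pred (toℕ i) n j))

  -- Signs, telescoping sums and the quadratic in `α`.

  fromℕℚ : ℕ → ℚ
  fromℕℚ k = fromℤ (+ k)

  fromℕℚ-+ : ∀ k l → fromℕℚ (k ℕ.+ l) ≡ fromℕℚ k + fromℕℚ l
  fromℕℚ-+ k l = fromℤ-+ (+ k) (+ l)

  2ℚ 4ℚ 6ℚ 7ℚ 12ℚ : ℚ
  2ℚ = fromℕℚ 2
  4ℚ = fromℕℚ 4
  6ℚ = fromℕℚ 6
  7ℚ = fromℕℚ 7
  12ℚ = fromℕℚ 12

  sign : ℕ → ℚ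
  sign zero    = 1ℚ
  sign (suc k) = - sign k

  sign-+ : ∀ k l → sign (k ℕ.+ l) ≡ sign k * sign l
  sign-+ zero    l = sym (*-identityˡ (sign l))
  sign-+ (suc k) l = trans (cong -_ (sign-+ k l)) (ring (sign k) (sign l))
    where
    ring : ∀ a b → - (a * b) ≡ - a * b
    ring = solve-∀ ℚ-ring

  sign-square : ∀ k → sign k * sign k ≡ 1ℚ
  sign-square zero    = refl
  sign-square (suc k) = trans (ring (sign k)) (sign-square k)
    where
    ring : ∀ a → - a * - a ≡ a * a
    ring = solve-∀ ℚ-ring

  sign-double : ∀ m → sign (m ℕ.+ m) ≡ 1ℚ
  sign-double m = trans (sign-+ m m) (sign-square m)

  fromℤ-sign : ∀ k → fromℤ (-1ℤ ℤ.^ k) ≡ sign k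
  fromℤ-sign zero    = refl
  fromℤ-sign (suc k) = trans (fromℤ-* -1ℤ (-1ℤ ℤ.^ k)) (trans (cong (fromℤ -1ℤ *_) (fromℤ-sign k)) (ring (sign k)))
    where
    ring : ∀ a → (- 1ℚ) * a ≡ - a
    ring = solve-∀ ℚ-ring

  fromℤ-square : ∀ z → fromℤ (z ℤ.^ 2) ≡ fromℤ z * fromℤ z
  fromℤ-square z = trans (cong (λ t → fromℤ (z ℤ.* t)) (ℤₚ.*-identityʳ z)) (fromℤ-* z z)

  fromℤ-minus : ∀ a b → fromℤ (a ℤ.- b) ≡ fromℤ a - fromℤ b
  fromℤ-minus a b = trans (fromℤ-+ a (ℤ.- b)) (cong (λ t → fromℤ a + t) (fromℤ-neg b))

  sum-telescope : (g G : ℕ → ℚ) → (∀ k → G (suc k) ≡ G k + g k) →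
                  ∀ n → sum {n} (g ∘ toℕ) ≡ G n - G 0
  sum-telescope g G step zero    = ring (G 0)
    where
    ring : ∀ a → 0ℚ ≡ a - a
    ring = solve-∀ ℚ-ring
  sum-telescope g G step (suc n) = begin
    g 0 + sum {n} (g ∘ suc ∘ toℕ)
      ≡⟨ cong (λ t → g 0 + t) (sum-telescope (g ∘ suc) (G ∘ suc) (step ∘ suc) n) ⟩
    g 0 + (G (suc n) - G 1)       ≡⟨ cong (λ t → g 0 + (G (suc n) - t)) (step 0) ⟩
    g 0 + (G (suc n) - (G 0 + g 0)) ≡⟨ ring (g 0) (G (suc n)) (G 0) ⟩
    G (suc n) - G 0 ∎
    where
    ring : ∀ a b c → a + (b - (c + a)) ≡ b - c
    ring = solve-∀ ℚ-ring

  -- The bracket of `α` carried over to ℚ; its second difference in κ is the constant -12.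
  parabola : ℚ → ℚ → ℚ
  parabola M κ = 2ℚ * (M * M) - 6ℚ * ((M - κ) * (M - κ)) + 7ℚ

  fromℤ-α : ∀ m k → fromℤ (α m k) ≡ - (sign k * parabola (fromℕℚ m) (fromℕℚ k))
  fromℤ-α m k = begin
    fromℤ (α m k)
      ≡⟨ trans (fromℤ-* (-1ℤ ℤ.^ (k ℕ.+ 1)) (a ℤ.- b ℤ.+ + 7))
               (cong₂ _*_ (trans (fromℤ-sign (k ℕ.+ 1)) (cong sign (ℕₚ.+-comm k 1))) (fromℤ-+ (a ℤ.- b) (+ 7))) ⟩
    - sign k * (fromℤ (a ℤ.- b) + 7ℚ)
      ≡⟨ cong (λ t → - sign k * (t + 7ℚ)) (trans (fromℤ-minus a b) (cong₂ _-_ a≡ b≡)) ⟩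
    - sign k * parabola M κ
      ≡⟨ ring (sign k) (parabola M κ) ⟩
    - (sign k * parabola M κ) ∎
    where
    M = fromℕℚ m
    κ = fromℕℚ k
    a = (+ 2) ℤ.* (+ m) ℤ.^ 2
    b = (+ 6) ℤ.* (+ m ℤ.- + k) ℤ.^ 2

    a≡ : fromℤ a ≡ 2ℚ * (M * M)
    a≡ = trans (fromℤ-* (+ 2) ((+ m) ℤ.^ 2)) (cong (2ℚ *_) (fromℤ-square (+ m)))

    b≡ : fromℤ b ≡ 6ℚ * ((M - κ) * (M - κ))
    b≡ = trans (fromℤ-* (+ 6) ((+ m ℤ.- + k) ℤ.^ 2))
      (cong (6ℚ *_) (trans (fromℤ-square (+ m ℤ.- + k)) (cong (λ t → t * t) (fromℤ-minus (+ m) (+ k)))))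

    ring : ∀ s t → - s * t ≡ - (s * t)
    ring = solve-∀ ℚ-ring

  -- Bordered block matrices.

  ·-blocks : ∀ {n} (u v : Vector ℚ (1 ℕ.+ (n ℕ.+ n))) →
             u · v ≡ u zero * v zero + ((λ i → u (suc (i ↑ˡ n))) · (λ i → v (suc (i ↑ˡ n)))
                                      + (λ i → u (suc (n ↑ʳ i))) · (λ i → v (suc (n ↑ʳ i))))
  ·-blocks {n} u v = cong (λ t → u zero * v zero + t) (∑-++ {n} (λ i → u (suc i) * v (suc i)))

  ·-bordered : ∀ {n} (a d : ℚ) (b c e f : Vector ℚ n) →
               (a ∷ (b ++ c)) · (d ∷ (e ++ f)) ≡ a * d + (b · e + c · f)
  ·-bordered {n} a d b c e f = trans (·-blocks {n} (a ∷ (b ++ c)) (d ∷ (e ++ f)))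
    (cong (λ t → a * d + t) (cong₂ _+_ (·-cong (lookup-++ˡ b c) (lookup-++ˡ e f))
                                (·-cong (lookup-++ʳ b c) (lookup-++ʳ e f))))

  ·-linear : ∀ {n} (a b : ℚ) (u v w : Vector ℚ n) →
             u · (λ i → a * v i + b * w i) ≡ a * (u · v) + b * (u · w)
  ·-linear a b u v w = trans (·-distribˡ u (λ i → a * v i) (λ i → b * w i)) (cong₂ _+_ (·-scaleˡ a u v) (·-scaleˡ b u w))

  -- Copies the block form of `L`, so that `L` is an instance by definition while the corner and the
  -- two blocks stay abstract.
  bordered : ∀ {n} → ℚ → Matrix n n → Matrix n n → Matrix (1 ℕ.+ (n ℕ.+ n)) (1 ℕ.+ (n ℕ.+ n))
  bordered {n} d A B =
      (d ∷ (replicate n (- ½) ++ replicate n 0ℚ))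
    ∷ ((λ i → - ½ ∷ (A i ++ B i)) ++ (λ i → 0ℚ ∷ (B i ++ identity n i)))

  module Bordered {n : ℕ} (d : ℚ) (A B : Matrix n n) where
    top    = λ i → - ½ ∷ (A i ++ B i)
    bottom = λ i → 0ℚ ∷ (B i ++ identity n i)

    row-top : ∀ i → bordered d A B (suc (i ↑ˡ n)) ≡ top i
    row-top i = lookup-++ˡ top bottom i

    row-bottom : ∀ i → bordered d A B (suc (n ↑ʳ i)) ≡ bottom i
    row-bottom i = lookup-++ʳ top bottom i

    ·-column : ∀ a (b c : Vector ℚ n) j →
      (a ∷ (b ++ c)) · transpose (bordered d A B) j ≡
      a * bordered d A B zero j + (b · (λ i → top i j) + c · (λ i → bottom i j))
    ·-column a b c j = trans (·-blocks {n} (a ∷ (b ++ c)) (transpose (bordered d A B) j))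
      (cong (λ t → a * bordered d A B zero j + t) (cong₂ _+_
        (·-cong (lookup-++ˡ b c) (λ i → cong (λ f → f j) (row-top i)))
        (·-cong (lookup-++ʳ b c) (λ i → cong (λ f → f j) (row-bottom i)))))

    -- One hypothesis per type of column; it is applied to both functionals that cut out the column
    -- space.
    ·-columns≡0 : ∀ a (b c : Vector ℚ n) →
      a * d + b · replicate n (- ½) ≡ 0ℚ →
      (∀ j → a * - ½ + (b · (λ i → A i j) + c · (λ i → B i j)) ≡ 0ℚ) →
      (∀ j → b · (λ i → B i j) + c j ≡ 0ℚ) →
      ∀ j → (a ∷ (b ++ c)) · transpose (bordered d A B) j ≡ 0ℚ
    ·-columns≡0 a b c first middle end zero = begin
      (a ∷ (b ++ c)) · transpose (bordered d A B) zero ≡⟨ ·-column a b c zero ⟩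
      a * d + (b · replicate n (- ½) + c · replicate n 0ℚ)
        ≡⟨ cong (λ t → a * d + (b · replicate n (- ½) + t)) (∑-zero (λ i → c i * 0ℚ) (λ i → *-zeroʳ (c i))) ⟩
      a * d + (b · replicate n (- ½) + 0ℚ)
        ≡⟨ cong (λ t → a * d + t) (+-identityʳ (b · replicate n (- ½))) ⟩
      a * d + b · replicate n (- ½) ≡⟨ first ⟩
      0ℚ ∎
    ·-columns≡0 a b c first middle end (suc j) = ↑-cases {n} {n} P left right j
      where
      P : Fin (n ℕ.+ n) → Set
      P j = (a ∷ (b ++ c)) · transpose (bordered d A B) (suc j) ≡ 0ℚ

      left : ∀ j → P (j ↑ˡ n)
      left j = begin
        (a ∷ (b ++ c)) · transpose (bordered d A B) (suc (j ↑ˡ n)) ≡⟨ ·-column a b c (suc (j ↑ˡ n)) ⟩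
        a * (replicate n (- ½) ++ replicate n 0ℚ) (j ↑ˡ n) + (b · (λ i → (A i ++ B i) (j ↑ˡ n)) + c · (λ i → (B i ++ identity n i) (j ↑ˡ n)))
          ≡⟨ cong₂ _+_ (cong (a *_) (lookup-++ˡ (replicate n (- ½)) (replicate n 0ℚ) j))
               (cong₂ _+_ (·-cong {u = b} (λ _ → refl) (λ i → lookup-++ˡ (A i) (B i) j))
                          (·-cong {u = c} (λ _ → refl) (λ i → lookup-++ˡ (B i) (identity n i) j))) ⟩
        a * - ½ + (b · (λ i → A i j) + c · (λ i → B i j)) ≡⟨ middle j ⟩
        0ℚ ∎

      right : ∀ j → P (n ↑ʳ j)
      right j = begin
        (a ∷ (b ++ c)) · transpose (bordered d A B) (suc (n ↑ʳ j)) ≡⟨ ·-column a b c (suc (n ↑ʳ j)) ⟩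
        a * (replicate n (- ½) ++ replicate n 0ℚ) (n ↑ʳ j) + (b · (λ i → (A i ++ B i) (n ↑ʳ j)) + c · (λ i → (B i ++ identity n i) (n ↑ʳ j)))
          ≡⟨ cong₂ _+_ (trans (cong (a *_) (lookup-++ʳ (replicate n (- ½)) (replicate n 0ℚ) j)) (*-zeroʳ a))
               (cong₂ _+_ (·-cong {u = b} (λ _ → refl) (λ i → lookup-++ʳ (A i) (B i) j))
                          (·-cong {u = c} (λ _ → refl) (λ i → trans (lookup-++ʳ (B i) (identity n i) j) (identity-sym i j)))) ⟩
        0ℚ + (b · (λ i → B i j) + c · identity n j) ≡⟨ +-identityˡ _ ⟩
        b · (λ i → B i j) + c · identity n j ≡⟨ cong (λ t → b · (λ i → B i j) + t) (·-identityʳ c j) ⟩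
        b · (λ i → B i j) + c j ≡⟨ end j ⟩
        0ℚ ∎

    ∈Span-bordered : ∀ (z : Vector ℚ (1 ℕ.+ (n ℕ.+ n))) (b c : Vector ℚ n) →
      z zero ≡ b · replicate n (- ½) →
      (∀ i → z (suc (i ↑ˡ n)) ≡ b · A i + c · B i) →
      (∀ i → z (suc (n ↑ʳ i)) ≡ b · B i + c i) →
      z ∈Span transpose (bordered d A B)
    ∈Span-bordered z b c first middle end = coefficients , eq
      where
      coefficients = 0ℚ ∷ (b ++ c)

      eq : z ≗ combination coefficients (transpose (bordered d A B))
      eq zero = trans first (sym (begin
        coefficients · bordered d A B zero ≡⟨ ·-bordered 0ℚ d b c (replicate n (- ½)) (replicate n 0ℚ) ⟩
        0ℚ * d + (b · replicate n (- ½) + c · replicate n 0ℚ)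
          ≡⟨ cong₂ (λ s t → s + (b · replicate n (- ½) + t)) (*-zeroˡ d) (∑-zero (λ i → c i * 0ℚ) (λ i → *-zeroʳ (c i))) ⟩
        0ℚ + (b · replicate n (- ½) + 0ℚ) ≡⟨ ring (b · replicate n (- ½)) ⟩
        b · replicate n (- ½) ∎))
        where
        ring : ∀ a → 0ℚ + (a + 0ℚ) ≡ a
        ring = solve-∀ ℚ-ring
      eq (suc i) = ↑-cases {n} {n} (λ i → z (suc i) ≡ coefficients · bordered d A B (suc i)) left right i
        where
        ring : ∀ a → 0ℚ + a ≡ a
        ring = solve-∀ ℚ-ring
        left : ∀ i → z (suc (i ↑ˡ n)) ≡ coefficients · bordered d A B (suc (i ↑ˡ n))
        left i = trans (middle i) (sym (begin
          coefficients · bordered d A B (suc (i ↑ˡ n)) ≡⟨ cong (coefficients ·_) (row-top i) ⟩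
          coefficients · top i ≡⟨ ·-bordered 0ℚ (- ½) b c (A i) (B i) ⟩
          0ℚ + (b · A i + c · B i) ≡⟨ ring (b · A i + c · B i) ⟩
          b · A i + c · B i ∎))
        right : ∀ i → z (suc (n ↑ʳ i)) ≡ coefficients · bordered d A B (suc (n ↑ʳ i))
        right i = trans (end i) (sym (begin
          coefficients · bordered d A B (suc (n ↑ʳ i)) ≡⟨ cong (coefficients ·_) (row-bottom i) ⟩
          coefficients · bottom i ≡⟨ ·-bordered 0ℚ 0ℚ b c (B i) (identity n i) ⟩
          0ℚ + (b · B i + c · identity n i) ≡⟨ ring (b · B i + c · identity n i) ⟩
          b · B i + c · identity n i ≡⟨ cong (λ t → b · B i + t) (·-identityʳ c i) ⟩
          b · B i + c i ∎))

  -- The alternating vector w on a cycle of even length.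

  module Alternating (m l : ℕ) (N≡2m : 2 ℕ.+ l ≡ m ℕ.+ m) where

    N = 2 ℕ.+ l
    M = fromℕℚ m

    N≡M+M : fromℕℚ N ≡ M + M
    N≡M+M = trans (cong fromℕℚ N≡2m) (fromℕℚ-+ m m)

    w : Vector ℚ N
    w i = sign (toℕ i)

    sign-N : sign N ≡ 1ℚ
    sign-N = trans (cong sign N≡2m) (sign-double m)

    w-pred : ∀ i → w (pred i) ≡ - w i
    -- Here the step wraps to the last index, whose sign is -1 because N is even.
    w-pred zero    = trans (cong sign (toℕ-fromℕ (suc l))) (trans (ring (sign (suc l))) (cong -_ sign-N))
      where
      ring : ∀ a → a ≡ - (- a)
      ring = solve-∀ ℚ-ring
    w-pred (suc i) = trans (cong sign (toℕ-inject₁ i)) (ring (sign (toℕ i)))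
      where
      ring : ∀ a → a ≡ - (- a)
      ring = solve-∀ ℚ-ring

    w-succ : ∀ i → w (succ i) ≡ - w i
    w-succ i = trans (ring (w (succ i))) (cong -_ (trans (sym (w-pred (succ i))) (cong w (pred-succ i))))
      where
      ring : ∀ a → a ≡ - (- a)
      ring = solve-∀ ℚ-ring

    neighbours-w : ∀ i → neighbours w i ≡ 0ℚ
    neighbours-w i = trans (cong₂ (λ s t → s + (w i + w i) + t) (w-pred i) (w-succ i)) (ring (w i))
      where
      ring : ∀ a → - a + (a + a) + - a ≡ 0ℚ
      ring = solve-∀ ℚ-ring

    -- `w` is the character of order two of ℤ/N, so ww′ is the circulant generated by `w`.
    w-⊖ : ∀ i j → w (j ⊖ i) ≡ w i * w j
    w-⊖ i j = go (toℕ i) j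
      where
      ring : ∀ a b → a * - b ≡ - a * b
      ring = solve-∀ ℚ-ring
      go : ∀ k j → w (iterate pred j k) ≡ sign k * w j
      go zero    j = sym (*-identityˡ (w j))
      go (suc k) j = trans (go k (pred j)) (trans (cong (sign k *_) (w-pred j)) (ring (sign k) (w j)))

    w·w≡N : w · w ≡ fromℕℚ N
    w·w≡N = trans (sum-cong-≗ {N} (λ i → sign-square (toℕ i)))
      (trans (sum-telescope (λ _ → 1ℚ) fromℕℚ (λ k → trans (fromℕℚ-+ 1 k) (ring (fromℕℚ k))) N) (ring′ (fromℕℚ N)))
      where
      ring : ∀ a → 1ℚ + a ≡ a + 1ℚ
      ring = solve-∀ ℚ-ring
      ring′ : ∀ a → a - 0ℚ ≡ a
      ring′ = solve-∀ ℚ-ring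

    ones : Vector ℚ N
    ones = replicate N 1ℚ

    -- A cyclic shift preserves the sum of the entries but negates `w`, so the sum equals its own
    -- negative.
    ones·w≡0 : ones · w ≡ 0ℚ
    ones·w≡0 = begin
      ones · w                         ≡⟨ sum-cong-≗ (λ i → *-identityˡ (w i)) ⟩
      s                                ≡⟨ ring s ⟩
      ½ * (s + s)
        ≡⟨ cong (λ t → ½ * (s + t)) (trans (sym (sum-pred w)) (sum-cong-≗ λ i → trans (w-pred i) (ring′ (w i)))) ⟩
      ½ * (s + sum (λ i → - 1ℚ * w i)) ≡⟨ cong (λ t → ½ * (s + t)) (sym (*-distribˡ-sum (- 1ℚ) w)) ⟩
      ½ * (s + - 1ℚ * s)               ≡⟨ ring″ s ⟩
      0ℚ                               ∎
      where
      s = sum w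
      ring : ∀ a → a ≡ ½ * (a + a)
      ring = solve-∀ ℚ-ring
      ring′ : ∀ a → - a ≡ - 1ℚ * a
      ring′ = solve-∀ ℚ-ring
      ring″ : ∀ a → ½ * (a + - 1ℚ * a) ≡ 0ℚ
      ring″ = solve-∀ ℚ-ring

    -- The alternating quadratic that generates Q.

    module Generators (c : ℚ) (c*6N≡1 : c * (6ℚ * (M + M)) ≡ 1ℚ) where

      e₀ = identity N zero

      -- The first row of A is e₀ + q: the factor 2m² − 6(m − k)² + 7 is symmetric under
      -- k ↦ 2m − k, so both halves of x follow one formula.
      X : ℕ → ℚ
      X k = - (sign k * parabola M (fromℕℚ k)) * c

      q : Vector ℚ N
      q i = X (toℕ i)

      -- The alternating sign turns the weights 1, 2, 1 into a second difference of `parabola`,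
      -- which is -12 everywhere.
      X-second-difference : ∀ k → X k + (X (suc k) + X (suc k)) + X (2 ℕ.+ k) ≡ - (12ℚ * c * sign (suc k))
      X-second-difference k =
        trans (cong₂ (λ s t → X k + (s + s) + t)
                (cong (λ t → - (- sign k * parabola M t) * c) (fromℕℚ-+ 1 k))
                (cong (λ t → - (- (- sign k) * parabola M t) * c) (fromℕℚ-+ 2 k)))
              (ring M (fromℕℚ k) (sign k) c)
        where
        -- The ring solver treats parabola as opaque, hence its expansion here and below.
        ring : ∀ M κ s c →
          - (s * (2ℚ * (M * M) - 6ℚ * ((M - κ) * (M - κ)) + 7ℚ)) * c
          + (- (- s * (2ℚ * (M * M) - 6ℚ * ((M - (1ℚ + κ)) * (M - (1ℚ + κ))) + 7ℚ)) * c
            + - (- s * (2ℚ * (M * M) - 6ℚ * ((M - (1ℚ + κ)) * (M - (1ℚ + κ))) + 7ℚ)) * c)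
          + - (- (- s) * (2ℚ * (M * M) - 6ℚ * ((M - (2ℚ + κ)) * (M - (2ℚ + κ))) + 7ℚ)) * c
          ≡ - (12ℚ * c * - s)
        ring = solve-∀ ℚ-ring

      -- 0 and N = 2M are mirror images about M. Only this value matches: `X (suc N)` and `X 1`
      -- differ in general, which is the kink at 0.
      X-periodic : X N ≡ X 0
      X-periodic = trans (cong₂ (λ s t → - (s * parabola M t) * c) sign-N N≡M+M) (ring M c)
        where
        ring : ∀ M c → - (1ℚ * (2ℚ * (M * M) - 6ℚ * ((M - (M + M)) * (M - (M + M))) + 7ℚ)) * c
                     ≡ - (1ℚ * (2ℚ * (M * M) - 6ℚ * ((M - 0ℚ) * (M - 0ℚ)) + 7ℚ)) * c
        ring = solve-∀ ℚ-ring

      -- Continuing the parabola to -1 would give only -12c. Its value at N - 1 exceeds the one at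
      -- -1 by 24M, and c = 1/(12M) scales this to the 2 that becomes 2I.
      X-around-0 : X (suc l) + (X 0 + X 0) + X 1 ≡ 2ℚ - 12ℚ * c
      X-around-0 = begin
        X (suc l) + (X 0 + X 0) + X 1
          ≡⟨ cong₂ (λ s t → - (s * parabola M t) * c + (X 0 + X 0) + X 1) sign-last last≡ ⟩
        - (- 1ℚ * parabola M (M + M - 1ℚ)) * c + (X 0 + X 0) + X 1
          ≡⟨ ring M c ⟩
        2ℚ * (c * (6ℚ * (M + M))) - 12ℚ * c
          ≡⟨ cong (λ t → 2ℚ * t - 12ℚ * c) c*6N≡1 ⟩
        2ℚ * 1ℚ - 12ℚ * c ≡⟨⟩
        2ℚ - 12ℚ * c ∎
        where
        sign-last : sign (suc l) ≡ - 1ℚ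
        sign-last = trans (ring′ (sign (suc l))) (cong -_ sign-N)
          where
          ring′ : ∀ a → a ≡ - (- a)
          ring′ = solve-∀ ℚ-ring
        last≡ : fromℕℚ (suc l) ≡ M + M - 1ℚ
        last≡ = trans (ring′ (fromℕℚ (suc l))) (cong (_- 1ℚ) (trans (sym (fromℕℚ-+ 1 (suc l))) N≡M+M))
          where
          ring′ : ∀ a → a ≡ 1ℚ + a - 1ℚ
          ring′ = solve-∀ ℚ-ring
        ring : ∀ M c →
          - (- 1ℚ * (2ℚ * (M * M) - 6ℚ * ((M - (M + M - 1ℚ)) * (M - (M + M - 1ℚ))) + 7ℚ)) * c
          + (- (1ℚ * (2ℚ * (M * M) - 6ℚ * ((M - 0ℚ) * (M - 0ℚ)) + 7ℚ)) * c
            + - (1ℚ * (2ℚ * (M * M) - 6ℚ * ((M - 0ℚ) * (M - 0ℚ)) + 7ℚ)) * c)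
          + - (- 1ℚ * (2ℚ * (M * M) - 6ℚ * ((M - 1ℚ) * (M - 1ℚ)) + 7ℚ)) * c
          ≡ 2ℚ * (c * (6ℚ * (M + M))) - 12ℚ * c
        ring = solve-∀ ℚ-ring

      neighbours-q : ∀ i → neighbours q i ≡ 2ℚ * e₀ i - 12ℚ * c * w i
      -- `succ` is an iterate and does not reduce, whereas `pred` computes by cases. Centring at
      -- `pred j` makes all three indices explicit.
      neighbours-q i = trans (sym (cong (neighbours q) (pred-succ i))) (trans (at-pred (succ i)) (cong (λ i → 2ℚ * e₀ i - 12ℚ * c * w i) (pred-succ i)))
        where
        ring : ∀ a → - a ≡ 0ℚ - a
        ring = solve-∀ ℚ-ring

        at-pred : ∀ j → neighbours q (pred j) ≡ 2ℚ * e₀ (pred j) - 12ℚ * c * w (pred j)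
        at-pred j = trans (cong (λ t → q (pred (pred j)) + (q (pred j) + q (pred j)) + q t) (succ-pred j)) (cases j)
          where
          cases : ∀ j → q (pred (pred j)) + (q (pred j) + q (pred j)) + q j ≡ 2ℚ * e₀ (pred j) - 12ℚ * c * w (pred j)
          -- The centre is the last index; its successor wraps to 0, and the value there is read as
          -- `X N`.
          cases zero rewrite toℕ-inject₁ (fromℕ l) | toℕ-fromℕ l =
            trans (cong (λ t → X l + (X (suc l) + X (suc l)) + t) (sym X-periodic))
                  (trans (X-second-difference l) (ring (12ℚ * c * sign (suc l))))
          -- The centre is index 0, where the kink contributes `2ℚ * e₀`.
          cases (suc zero) rewrite toℕ-fromℕ l = trans X-around-0 (ring′ c)
            where
            ring′ : ∀ c → 2ℚ - 12ℚ * c ≡ 2ℚ * 1ℚ - 12ℚ * c * 1ℚ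
            ring′ = solve-∀ ℚ-ring
          cases (suc (suc k)) rewrite toℕ-inject₁ (inject₁ k) | toℕ-inject₁ k =
            trans (X-second-difference (toℕ k)) (ring (12ℚ * c * sign (suc (toℕ k))))

      -- The signs square away, leaving -c times the sum of `parabola` over a period. Without the
      -- constant 7 that sum is -N; with it, 6N = 1/c.
      w·q≡-1 : w · q ≡ - 1ℚ
      w·q≡-1 = begin
        w · q ≡⟨ sum-cong-≗ {N} (λ i → trans (ring (sign (toℕ i)) (parabola M (fromℕℚ (toℕ i))) c)
                   (trans (cong (λ s → - c * (s * parabola M (fromℕℚ (toℕ i)))) (sign-square (toℕ i)))
                     (cong (- c *_) (*-identityˡ (parabola M (fromℕℚ (toℕ i))))))) ⟩
        sum {N} (λ i → - c * parabola M (fromℕℚ (toℕ i)))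
          ≡⟨ *-distribˡ-sum {N} (- c) (λ i → parabola M (fromℕℚ (toℕ i))) ⟨
        - c * sum {N} (λ i → parabola M (fromℕℚ (toℕ i)))
          ≡⟨ cong (- c *_) (sum-telescope (parabola M ∘ fromℕℚ) (F M ∘ fromℕℚ) F-step N) ⟩
        - c * (F M (fromℕℚ N) - F M 0ℚ) ≡⟨ cong (λ t → - c * (F M t - F M 0ℚ)) N≡M+M ⟩
        - c * (F M (M + M) - F M 0ℚ) ≡⟨ ring′ M c ⟩
        - (c * (6ℚ * (M + M))) ≡⟨ cong -_ c*6N≡1 ⟩
        - 1ℚ ∎
        where
        -- F M κ = Σ_{k < κ} parabola M k.
        F : ℚ → ℚ → ℚ
        F M κ = κ * (2ℚ * (M * M) + 7ℚ) - 6ℚ * (κ * (M * M)) + 6ℚ * (M * (κ * (κ - 1ℚ))) - κ * ((κ - 1ℚ) * (2ℚ * κ - 1ℚ))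
        ring : ∀ s p c → s * (- (s * p) * c) ≡ - c * (s * s * p)
        ring = solve-∀ ℚ-ring
        ring′ : ∀ M c → - c * (((M + M) * (2ℚ * (M * M) + 7ℚ) - 6ℚ * ((M + M) * (M * M)) + 6ℚ * (M * ((M + M) * (M + M - 1ℚ))) - (M + M) * ((M + M - 1ℚ) * (2ℚ * (M + M) - 1ℚ)))
                 - (0ℚ * (2ℚ * (M * M) + 7ℚ) - 6ℚ * (0ℚ * (M * M)) + 6ℚ * (M * (0ℚ * (0ℚ - 1ℚ))) - 0ℚ * ((0ℚ - 1ℚ) * (2ℚ * 0ℚ - 1ℚ))))
                ≡ - (c * (6ℚ * (M + M)))
        ring′ = solve-∀ ℚ-ring
        F-step : ∀ k → F M (fromℕℚ (suc k)) ≡ F M (fromℕℚ k) + parabola M (fromℕℚ k)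
        F-step k = trans (cong (F M) (fromℕℚ-+ 1 k)) (ring″ M (fromℕℚ k))
          where
          ring″ : ∀ M κ →
            (1ℚ + κ) * (2ℚ * (M * M) + 7ℚ) - 6ℚ * ((1ℚ + κ) * (M * M)) + 6ℚ * (M * ((1ℚ + κ) * (1ℚ + κ - 1ℚ))) - (1ℚ + κ) * ((1ℚ + κ - 1ℚ) * (2ℚ * (1ℚ + κ) - 1ℚ))
            ≡ κ * (2ℚ * (M * M) + 7ℚ) - 6ℚ * (κ * (M * M)) + 6ℚ * (M * (κ * (κ - 1ℚ))) - κ * ((κ - 1ℚ) * (2ℚ * κ - 1ℚ)) + (2ℚ * (M * M) - 6ℚ * ((M - κ) * (M - κ)) + 7ℚ)
          ring″ = solve-∀ ℚ-ring

      -- The column space of the bordered matrix.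

      module Rank (d : ℚ) (A B : Matrix N N)
                  (d≡M : d ≡ M)
                  (A≡ : ∀ i j → A i j ≡ identity N i j + q (j ⊖ i))
                  (B≡ : ∀ i j → B i j ≡ - identity N i j + 6ℚ * c * (w i * w j)) where

        -- `ones` is an eigenvector of `neighbours` with eigenvalue 4, so self-adjointness gives 4Σq
        -- = 2 without summing the alternating quadratic.
        ones·q≡½ : ones · q ≡ ½
        ones·q≡½ = begin
          ones · q ≡⟨ ring (ones · q) ⟩
          ½ * (½ * (4ℚ * (ones · q))) ≡⟨ cong (λ t → ½ * (½ * t)) (·-scale-4 q) ⟩
          ½ * (½ * (neighbours ones · q)) ≡⟨ cong (λ t → ½ * (½ * t)) (sym (·-neighbours ones q)) ⟩
          ½ * (½ * (ones · neighbours q)) ≡⟨ cong (λ t → ½ * (½ * t)) (·-neighbours-q ones) ⟩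
          ½ * (½ * (2ℚ * 1ℚ + - (12ℚ * c) * (ones · w)))
            ≡⟨ cong (λ t → ½ * (½ * (2ℚ * 1ℚ + - (12ℚ * c) * t))) ones·w≡0 ⟩
          ½ * (½ * (2ℚ * 1ℚ + - (12ℚ * c) * 0ℚ)) ≡⟨ ring′ (- (12ℚ * c)) ⟩
          ½ ∎
          where
          ring : ∀ a → a ≡ ½ * (½ * (4ℚ * a))
          ring = solve-∀ ℚ-ring
          ring′ : ∀ a → ½ * (½ * (2ℚ * 1ℚ + a * 0ℚ)) ≡ ½
          ring′ = solve-∀ ℚ-ring
          ·-scale-4 : ∀ v → 4ℚ * (ones · v) ≡ neighbours ones · v
          ·-scale-4 v = trans (*-distribˡ-sum {N} (4ℚ) (λ i → 1ℚ * v i)) (sum-cong-≗ {N} (λ i → ring″ (v i)))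
            where
            ring″ : ∀ a → 4ℚ * (1ℚ * a) ≡ (1ℚ + (1ℚ + 1ℚ) + 1ℚ) * a
            ring″ = solve-∀ ℚ-ring
          ·-neighbours-q : ∀ u → u · neighbours q ≡ 2ℚ * u zero + - (12ℚ * c) * (u · w)
          ·-neighbours-q u = begin
            u · neighbours q
              ≡⟨ ·-cong {u = u} (λ _ → refl) (λ i → trans (neighbours-q i) (ring″ (e₀ i) c (w i))) ⟩
            u · (λ i → 2ℚ * e₀ i + - (12ℚ * c) * w i) ≡⟨ ·-linear 2ℚ (- (12ℚ * c)) u e₀ w ⟩
            2ℚ * (u · e₀) + - (12ℚ * c) * (u · w)
              ≡⟨ cong (λ t → 2ℚ * t + - (12ℚ * c) * (u · w)) (·-identityʳ u zero) ⟩
            2ℚ * u zero + - (12ℚ * c) * (u · w) ∎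
            where
            ring″ : ∀ e c w → 2ℚ * e - 12ℚ * c * w ≡ 2ℚ * e + - (12ℚ * c) * w
            ring″ = solve-∀ ℚ-ring

        ·-rowB : ∀ u i → u · B i ≡ - u i + 6ℚ * c * (w i * (u · w))
        ·-rowB u i = begin
          u · B i
            ≡⟨ ·-cong {u = u} (λ _ → refl) (λ j → trans (B≡ i j) (ring (identity N i j) c (w i) (w j))) ⟩
          u · (λ j → - 1ℚ * identity N i j + 6ℚ * c * w i * w j)
            ≡⟨ ·-linear (- 1ℚ) (6ℚ * c * w i) u (identity N i) w ⟩
          - 1ℚ * (u · identity N i) + 6ℚ * c * w i * (u · w)
            ≡⟨ cong (λ t → - 1ℚ * t + 6ℚ * c * w i * (u · w)) (·-identityʳ u i) ⟩
          - 1ℚ * u i + 6ℚ * c * w i * (u · w) ≡⟨ sym (ring (u i) c (w i) (u · w)) ⟩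
          - u i + 6ℚ * c * (w i * (u · w)) ∎
          where
          ring : ∀ e c a b → - e + 6ℚ * c * (a * b) ≡ - 1ℚ * e + 6ℚ * c * a * b
          ring = solve-∀ ℚ-ring

        ·-columnB : ∀ u j → u · (λ i → B i j) ≡ - u j + 6ℚ * c * (w j * (u · w))
        ·-columnB u j = trans (·-cong {u = u} (λ _ → refl) (λ i → B-sym i j)) (·-rowB u j)
          where
          B-sym : ∀ i j → B i j ≡ B j i
          B-sym i j = trans (B≡ i j) (trans (cong₂ (λ s t → - s + 6ℚ * c * t) (identity-sym i j) (*-comm (w i) (w j))) (sym (B≡ j i)))

        ·-rowA : ∀ u i → u · A i ≡ u i + u · (λ j → q (j ⊖ i))
        ·-rowA u i = trans (·-cong {u = u} (λ _ → refl) (A≡ i))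
          (trans (·-distribˡ u (identity N i) (λ j → q (j ⊖ i))) (cong (λ t → t + u · (λ j → q (j ⊖ i))) (·-identityʳ u i)))

        ·-columnA : ∀ u j → u · (λ i → A i j) ≡ u j + u · (λ i → q (j ⊖ i))
        ·-columnA u j = trans (·-cong {u = u} (λ _ → refl) (λ i → trans (A≡ i j) (cong (_+ q (j ⊖ i)) (identity-sym i j))))
          (trans (·-distribˡ u (identity N j) (λ i → q (j ⊖ i))) (cong (λ t → t + u · (λ i → q (j ⊖ i))) (·-identityʳ u j)))

        -- The operator moves from `h` to the row of Q, where it leaves 2I - 2ww′/N, since 12c =
        -- 2/N.
        neighbours-row-q : ∀ h i → neighbours h · (λ j → q (j ⊖ i)) ≡ 2ℚ * h i - 12ℚ * c * (w i * (h · w))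
        neighbours-row-q h i = begin
          neighbours h · qᵢ ≡⟨ ·-neighbours h qᵢ ⟨
          h · neighbours qᵢ
            ≡⟨ ·-cong {u = h} (λ _ → refl) (λ j → trans (neighbours-⊖ q i j) (trans (neighbours-q (j ⊖ i))
               (trans (cong₂ (λ s t → 2ℚ * s - 12ℚ * c * t) (identity-⊖ i j) (w-⊖ i j)) (ring (identity N i j) c (w i) (w j))))) ⟩
          h · (λ j → 2ℚ * identity N i j + - (12ℚ * c * w i) * w j)
            ≡⟨ ·-linear 2ℚ (- (12ℚ * c * w i)) h (identity N i) w ⟩
          2ℚ * (h · identity N i) + - (12ℚ * c * w i) * (h · w)
            ≡⟨ cong (λ t → 2ℚ * t + - (12ℚ * c * w i) * (h · w)) (·-identityʳ h i) ⟩
          2ℚ * h i + - (12ℚ * c * w i) * (h · w) ≡⟨ sym (ring (h i) c (w i) (h · w)) ⟩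
          2ℚ * h i - 12ℚ * c * (w i * (h · w)) ∎
          where
          qᵢ = λ j → q (j ⊖ i)
          ring : ∀ e c a b → 2ℚ * e - 12ℚ * c * (a * b) ≡ 2ℚ * e + - (12ℚ * c * a) * b
          ring = solve-∀ ℚ-ring

        w·column-q : ∀ j → w · (λ i → q (j ⊖ i)) ≡ - w j
        w·column-q j = begin
          -- Inserting `w j * w j` = 1 turns `w i` into `w j * w (j ⊖ i)`; the summand then depends
          -- on `i` only through `j ⊖ i`.
          w · (λ i → q (j ⊖ i)) ≡⟨ sum-cong-≗ {N} (λ i → trans (ring (w i) (q (j ⊖ i)))
               (trans (cong (λ t → w i * t * q (j ⊖ i)) (sym (sign-square (toℕ j))))
                 (trans (ring′ (w i) (w j) (q (j ⊖ i))) (cong (λ t → w j * (t * q (j ⊖ i))) (sym (w-⊖ i j)))))) ⟩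
          sum {N} (λ i → w j * (w (j ⊖ i) * q (j ⊖ i))) ≡⟨ sum-⊖ (λ k → w j * (w k * q k)) j ⟩
          sum {N} (λ k → w j * (w k * q k)) ≡⟨ *-distribˡ-sum {N} (w j) (λ k → w k * q k) ⟨
          w j * (w · q) ≡⟨ cong (w j *_) w·q≡-1 ⟩
          w j * - 1ℚ ≡⟨ ring″ (w j) ⟩
          - w j ∎
          where
          ring : ∀ a b → a * b ≡ a * 1ℚ * b
          ring = solve-∀ ℚ-ring
          ring′ : ∀ a b c → a * (b * b) * c ≡ b * (a * b * c)
          ring′ = solve-∀ ℚ-ring
          ring″ : ∀ a → a * - 1ℚ ≡ - a
          ring″ = solve-∀ ℚ-ring

        open Bordered d A B

        zeros : Vector ℚ N
        zeros = replicate N 0ℚ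

        φ ψ : Vector ℚ (1 ℕ.+ (N ℕ.+ N))
        φ = 1ℚ ∷ (ones ++ ones)
        ψ = 0ℚ ∷ (w ++ zeros)

        ones·B≡-1 : ∀ j → ones · (λ i → B i j) ≡ - 1ℚ
        ones·B≡-1 j = trans (·-columnB ones j) (trans (cong (λ t → - 1ℚ + 6ℚ * c * (w j * t)) ones·w≡0) (ring c (w j)))
          where
          ring : ∀ c a → - 1ℚ + 6ℚ * c * (a * 0ℚ) ≡ - 1ℚ
          ring = solve-∀ ℚ-ring

        w·B≡0 : ∀ j → w · (λ i → B i j) ≡ 0ℚ
        w·B≡0 j = begin
          w · (λ i → B i j) ≡⟨ ·-columnB w j ⟩
          - w j + 6ℚ * c * (w j * (w · w))
            ≡⟨ cong (λ t → - w j + 6ℚ * c * (w j * t)) (trans w·w≡N N≡M+M) ⟩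
          - w j + 6ℚ * c * (w j * (M + M)) ≡⟨ ring c (w j) M ⟩
          - w j + w j * (c * (6ℚ * (M + M))) ≡⟨ cong (λ t → - w j + w j * t) c*6N≡1 ⟩
          - w j + w j * 1ℚ ≡⟨ ring′ (w j) ⟩
          0ℚ ∎
          where
          ring : ∀ c a M → - a + 6ℚ * c * (a * (M + M)) ≡ - a + a * (c * (6ℚ * (M + M)))
          ring = solve-∀ ℚ-ring
          ring′ : ∀ a → - a + a * 1ℚ ≡ 0ℚ
          ring′ = solve-∀ ℚ-ring

        ·-constant : ∀ (u : Vector ℚ N) a → u · replicate N a ≡ a * (ones · u)
        ·-constant u a = trans (·-cong {u = u} (λ _ → refl) (λ _ → ring a))
          (trans (·-scaleˡ a u ones) (cong (a *_) (·-comm u ones)))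
          where
          ring : ∀ a → a ≡ a * 1ℚ
          ring = solve-∀ ℚ-ring

        φ-columns : ∀ j → φ · transpose (bordered d A B) j ≡ 0ℚ
        φ-columns = ·-columns≡0 1ℚ ones ones
          (begin
            1ℚ * d + ones · replicate N (- ½) ≡⟨ cong₂ (λ s t → 1ℚ * s + t) d≡M (·-constant ones (- ½)) ⟩
            1ℚ * M + - ½ * (ones · ones) ≡⟨ cong (λ t → 1ℚ * M + - ½ * t) ones·ones ⟩
            1ℚ * M + - ½ * (M + M) ≡⟨ ring M ⟩
            0ℚ ∎)
          (λ j → begin
            1ℚ * - ½ + (ones · (λ i → A i j) + ones · (λ i → B i j))
              ≡⟨ cong (λ t → 1ℚ * - ½ + t) (cong₂ _+_ (trans (·-columnA ones j)
                   (cong (λ t → 1ℚ + t) (trans (sum-⊖ (λ k → 1ℚ * q k) j) ones·q≡½))) (ones·B≡-1 j)) ⟩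
            1ℚ * - ½ + ((1ℚ + ½) + - 1ℚ) ≡⟨⟩
            0ℚ ∎)
          (λ j → cong (_+ 1ℚ) (ones·B≡-1 j))
          where
          ones·ones : ones · ones ≡ M + M
          ones·ones = trans (sum-cong-≗ {N} (λ i → sym (sign-square (toℕ i)))) (trans w·w≡N N≡M+M)
          ring : ∀ M → 1ℚ * M + - ½ * (M + M) ≡ 0ℚ
          ring = solve-∀ ℚ-ring

        ψ-columns : ∀ j → ψ · transpose (bordered d A B) j ≡ 0ℚ
        ψ-columns = ·-columns≡0 0ℚ w zeros
          (trans (cong (λ t → 0ℚ * d + t) (trans (·-constant w (- ½)) (cong (λ t → - ½ * t) ones·w≡0))) (ring d))
          (λ j → begin
            0ℚ * - ½ + (w · (λ i → A i j) + zeros · (λ i → B i j))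
              ≡⟨ cong₂ (λ s t → 0ℚ * - ½ + (s + t)) (trans (·-columnA w j) (cong (λ t → w j + t) (w·column-q j)))
                   (∑-zero (λ i → 0ℚ * B i j) (λ i → *-zeroˡ (B i j))) ⟩
            0ℚ * - ½ + (w j + - w j + 0ℚ) ≡⟨ ring′ (w j) ⟩
            0ℚ ∎)
          (λ j → trans (+-identityʳ (w · (λ i → B i j))) (w·B≡0 j))
          where
          ring : ∀ d → 0ℚ * d + - ½ * 0ℚ ≡ 0ℚ
          ring = solve-∀ ℚ-ring
          ring′ : ∀ a → 0ℚ * - ½ + (a + - a + 0ℚ) ≡ 0ℚ
          ring′ = solve-∀ ℚ-ring

        ∈Span-columns : ∀ z → φ · z ≡ 0ℚ → ψ · z ≡ 0ℚ → z ∈Span transpose (bordered d A B)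
        ∈Span-columns z φ·z≡0 ψ·z≡0 = ∈Span-bordered z u v first middle end
          where
          p r h u v : Vector ℚ N
          p i = z (suc (i ↑ˡ N))
          r i = z (suc (N ↑ʳ i))
          h i = p i + r i
          u i = ½ * neighbours h i
          v i = r i + u i

          z₀≡ : z zero ≡ - (ones · p + ones · r)
          z₀≡ = begin
            z zero ≡⟨ ring (z zero) (ones · p + ones · r) ⟩
            1ℚ * z zero + (ones · p + ones · r) - (ones · p + ones · r)
              ≡⟨ cong (_- (ones · p + ones · r)) (trans (cong (λ t → 1ℚ * z zero + t) (sym (cong₂ _+_
                   (·-cong {v = p} (lookup-++ˡ ones ones) (λ _ → refl)) (·-cong {v = r} (lookup-++ʳ ones ones) (λ _ → refl)))))
                   (trans (sym (·-blocks {N} φ z)) φ·z≡0)) ⟩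
            0ℚ - (ones · p + ones · r) ≡⟨ +-identityˡ _ ⟩
            - (ones · p + ones · r) ∎
            where
            ring : ∀ a b → a ≡ 1ℚ * a + b - b
            ring = solve-∀ ℚ-ring

          p·w≡0 : p · w ≡ 0ℚ
          p·w≡0 = begin
            p · w ≡⟨ ·-comm p w ⟩
            w · p ≡⟨ ring (z zero) (w · p) ⟩
            0ℚ * z zero + (w · p + 0ℚ)
              ≡⟨ cong (λ t → 0ℚ * z zero + (w · p + t)) (sym (∑-zero (λ i → 0ℚ * r i) (λ i → *-zeroˡ (r i)))) ⟩
            0ℚ * z zero + (w · p + zeros · r)
              ≡⟨ cong (λ t → 0ℚ * z zero + t) (sym (cong₂ _+_
                   (·-cong {v = p} (lookup-++ˡ w zeros) (λ _ → refl)) (·-cong {v = r} (lookup-++ʳ w zeros) (λ _ → refl)))) ⟩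
            _ ≡⟨ ·-blocks {N} ψ z ⟨
            ψ · z ≡⟨ ψ·z≡0 ⟩
            0ℚ ∎
            where
            ring : ∀ a b → b ≡ 0ℚ * a + (b + 0ℚ)
            ring = solve-∀ ℚ-ring

          ·u : ∀ a → a · u ≡ ½ * (neighbours a · h)
          ·u a = trans (·-scaleˡ ½ a (neighbours h)) (cong (½ *_) (·-neighbours a h))

          ones·u≡ : ones · u ≡ 2ℚ * (ones · p + ones · r)
          ones·u≡ = begin
            ones · u ≡⟨ ·u ones ⟩
            ½ * (neighbours ones · h) ≡⟨ cong (½ *_) (sum-cong-≗ {N} (λ i → ring (h i))) ⟩
            ½ * sum {N} (λ i → 4ℚ * (1ℚ * h i))
              ≡⟨ cong (½ *_) (sym (*-distribˡ-sum {N} (4ℚ) (λ i → 1ℚ * h i))) ⟩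
            ½ * (4ℚ * (ones · h)) ≡⟨ cong (λ t → ½ * (4ℚ * t)) (·-distribˡ ones p r) ⟩
            ½ * (4ℚ * (ones · p + ones · r)) ≡⟨ ring′ (ones · p + ones · r) ⟩
            2ℚ * (ones · p + ones · r) ∎
            where
            ring : ∀ a → (1ℚ + (1ℚ + 1ℚ) + 1ℚ) * a ≡ 4ℚ * (1ℚ * a)
            ring = solve-∀ ℚ-ring
            ring′ : ∀ a → ½ * (4ℚ * a) ≡ 2ℚ * a
            ring′ = solve-∀ ℚ-ring

          u·w≡0 : u · w ≡ 0ℚ
          u·w≡0 = trans (·-comm u w) (trans (·u w) (cong (½ *_)
            (∑-zero (λ i → neighbours w i * h i) (λ i → trans (cong (_* h i) (neighbours-w i)) (*-zeroˡ (h i))))))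

          v·w≡ : v · w ≡ r · w
          v·w≡ = trans (·-comm v w) (trans (·-distribˡ w r u) (trans (cong₂ _+_ (·-comm w r) (trans (·-comm w u) u·w≡0)) (+-identityʳ (r · w))))

          h·w≡ : h · w ≡ r · w
          h·w≡ = trans (·-comm h w) (trans (·-distribˡ w p r) (trans (cong₂ _+_ (trans (·-comm w p) p·w≡0) (·-comm w r)) (+-identityˡ (r · w))))

          first : z zero ≡ u · replicate N (- ½)
          first = trans z₀≡ (sym (trans (·-constant u (- ½)) (trans (cong (λ t → - ½ * t) ones·u≡) (ring (ones · p + ones · r)))))
            where
            ring : ∀ a → - ½ * (2ℚ * a) ≡ - a
            ring = solve-∀ ℚ-ring

          u·row-q : ∀ i → u · (λ j → q (j ⊖ i)) ≡ ½ * (2ℚ * h i - 12ℚ * c * (w i * (r · w)))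
          u·row-q i = begin
            u · qᵢ ≡⟨ ·-comm u qᵢ ⟩
            qᵢ · u ≡⟨ ·-scaleˡ ½ qᵢ (neighbours h) ⟩
            ½ * (qᵢ · neighbours h)
              ≡⟨ cong (½ *_) (trans (·-comm qᵢ (neighbours h)) (neighbours-row-q h i)) ⟩
            ½ * (2ℚ * h i - 12ℚ * c * (w i * (h · w)))
              ≡⟨ cong (λ t → ½ * (2ℚ * h i - 12ℚ * c * (w i * t))) h·w≡ ⟩
            ½ * (2ℚ * h i - 12ℚ * c * (w i * (r · w))) ∎
            where qᵢ = λ j → q (j ⊖ i)

          middle : ∀ i → p i ≡ u · A i + v · B i
          middle i = sym (begin
            u · A i + v · B i
              ≡⟨ cong₂ _+_ (trans (·-rowA u i) (cong (λ t → u i + t) (u·row-q i)))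
                           (trans (·-rowB v i) (cong (λ t → - v i + 6ℚ * c * (w i * t)) v·w≡)) ⟩
            u i + ½ * (2ℚ * (p i + r i) - 12ℚ * c * (w i * (r · w))) + (- (r i + u i) + 6ℚ * c * (w i * (r · w)))
              -- `h · w` and `v · w` both equal `r · w`, so the rank-one terms from Q and B, with
              -- coefficients -½·12c and 6c, cancel.
              ≡⟨ ring (u i) (p i) (r i) c (w i * (r · w)) ⟩
            p i ∎)
            where
            ring : ∀ u p r c s → u + ½ * (2ℚ * (p + r) - 12ℚ * c * s) + (- (r + u) + 6ℚ * c * s) ≡ p
            ring = solve-∀ ℚ-ring

          end : ∀ i → r i ≡ u · B i + v i
          end i = sym (trans (cong (_+ v i) (trans (·-rowB u i) (cong (λ t → - u i + 6ℚ * c * (w i * t)) u·w≡0))) (ring (u i) c (w i) (r i)))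
            where
            ring : ∀ u c w r → - u + 6ℚ * c * (w * 0ℚ) + (r + u) ≡ r
            ring = solve-∀ ℚ-ring

        hasRank-bordered : HasRank (bordered d A B) (suc l ℕ.+ N)
        -- The echelon conditions compute because `w` starts with 1, and 1 + (N + N) reduces to 2 +
        -- (`suc l` + N) since N = 2 + l.
        hasRank-bordered = hasRank-echelon (bordered d A B) φ ψ refl refl refl φ-columns ψ-columns ∈Span-columns

  -- Matching the entries of `L` with the abstract blocks.

  module Entries (m l : ℕ) (N≡2m : 2 ℕ.+ l ≡ m ℕ.+ m) (5≤n : 5 ≤ 3 ℕ.+ l) where
    open Alternating m l N≡2m

    c : ℚ
    c = 1ℤ / (6 ℕ.* N)

    c*6N≡1 : c * (6ℚ * (M + M)) ≡ 1ℚ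
    c*6N≡1 = begin
      c * (6ℚ * (M + M)) ≡⟨ cong (λ t → c * (6ℚ * t)) N≡M+M ⟨
      c * (6ℚ * fromℕℚ N)
        ≡⟨ cong (c *_) (trans (sym (fromℤ-* (+ 6) (+ N))) (cong fromℤ (sym (ℤₚ.pos-* 6 N)))) ⟩
      c * fromℕℚ (6 ℕ.* N)  ≡⟨ 1/n*n≡1 (6 ℕ.* N) ⟩
      1ℚ                    ∎

    open Generators c c*6N≡1

    -- Expresses the denominator of `y` through that of `x`, so one indeterminate serves both
    -- circulants.
    1/N≡6c : 1ℤ / N ≡ 6ℚ * c
    1/N≡6c = begin
      1ℤ / N ≡⟨ *-identityʳ (1ℤ / N) ⟨
      1ℤ / N * 1ℚ ≡⟨ cong (1ℤ / N *_) c*6N≡1 ⟨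
      1ℤ / N * (c * (6ℚ * (M + M))) ≡⟨ ring (1ℤ / N) c (M + M) ⟩
      (1ℤ / N * (M + M)) * (6ℚ * c) ≡⟨ cong (λ t → (1ℤ / N * t) * (6ℚ * c)) N≡M+M ⟨
      (1ℤ / N * fromℕℚ N) * (6ℚ * c) ≡⟨ cong (_* (6ℚ * c)) (1/n*n≡1 N) ⟩
      1ℚ * (6ℚ * c) ≡⟨ ring′ (6ℚ * c) ⟩
      6ℚ * c ∎
      where
      ring : ∀ a c M → a * (c * (6ℚ * M)) ≡ (a * M) * (6ℚ * c)
      ring = solve-∀ ℚ-ring
      ring′ : ∀ a → 1ℚ * a ≡ a
      ring′ = solve-∀ ℚ-ring

    n≡ : fromℕℚ (3 ℕ.+ l) ≡ 1ℚ + (M + M)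
    n≡ = trans (fromℕℚ-+ 1 N) (cong (λ t → 1ℚ + t) N≡M+M)

    corner : + N / 2 ≡ M
    corner = trans (/-as-* (+ N) 2) (trans (cong (_* ½) N≡M+M) (ring M))
      where
      ring : ∀ M → (M + M) * ½ ≡ M
      ring = solve-∀ ℚ-ring

    half-N : ⌊ N /2⌋ ≡ m
    half-N = trans (cong ⌊_/2⌋ N≡2m) (sym (ℕₚ.n≡⌊n+n/2⌋ m))

    sign-reflect : ∀ {k} → k ≤ N → sign (N ∸ k) ≡ sign k
    sign-reflect {k} k≤N = begin
      sign (N ∸ k) ≡⟨ *-identityʳ (sign (N ∸ k)) ⟨
      sign (N ∸ k) * 1ℚ ≡⟨ cong (sign (N ∸ k) *_) (sign-square k) ⟨
      sign (N ∸ k) * (sign k * sign k) ≡⟨ ring (sign (N ∸ k)) (sign k) ⟩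
      (sign (N ∸ k) * sign k) * sign k ≡⟨ cong (_* sign k) (sym (sign-+ (N ∸ k) k)) ⟩
      sign ((N ∸ k) ℕ.+ k) * sign k ≡⟨ cong (λ t → sign t * sign k) (ℕₚ.m∸n+n≡m k≤N) ⟩
      sign N * sign k ≡⟨ cong (_* sign k) sign-N ⟩
      1ℚ * sign k ≡⟨ ring′ (sign k) ⟩
      sign k ∎
      where
      ring : ∀ a b → a * (b * b) ≡ (a * b) * b
      ring = solve-∀ ℚ-ring
      ring′ : ∀ a → 1ℚ * a ≡ a
      ring′ = solve-∀ ℚ-ring

    parabola-reflect : ∀ {k} → k ≤ N → parabola M (fromℕℚ (N ∸ k)) ≡ parabola M (fromℕℚ k)
    parabola-reflect {k} k≤N = trans (cong (parabola M) reflected) (ring M (fromℕℚ k))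
      where
      reflected : fromℕℚ (N ∸ k) ≡ (M + M) - fromℕℚ k
      reflected = trans (ring′ (fromℕℚ (N ∸ k)) (fromℕℚ k))
        (cong (_- fromℕℚ k) (trans (sym (fromℕℚ-+ (N ∸ k) k)) (trans (cong fromℕℚ (ℕₚ.m∸n+n≡m k≤N)) N≡M+M)))
        where
        ring′ : ∀ a b → a ≡ (a + b) - b
        ring′ = solve-∀ ℚ-ring
      ring : ∀ M κ → 2ℚ * (M * M) - 6ℚ * ((M - ((M + M) - κ)) * (M - ((M + M) - κ))) + 7ℚ
                   ≡ 2ℚ * (M * M) - 6ℚ * ((M - κ) * (M - κ)) + 7ℚ
      ring = solve-∀ ℚ-ring

    -- The reflection k ↦ N - k preserves the sign, N being even, and the parabola. Both branches
    -- thus agree, and the comparison with `m` is treated as an arbitrary Boolean.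
    fromℤ-xNumerator : ∀ k → suc k ≤ N →
      fromℤ (xNumerator (3 ℕ.+ l) (suc k)) ≡ - (sign (suc k) * parabola M (fromℕℚ (suc k)))
    fromℤ-xNumerator k k<N = trans (cong (λ μ → fromℤ (branch μ)) half-N) (either (suc k ℕ.≤ᵇ m))
      where
      branch : ℕ → ℤ
      branch μ = if suc k ℕ.≤ᵇ μ then α μ (suc k) else α μ (N ∸ suc k)

      either : ∀ b → fromℤ (if b then α m (suc k) else α m (N ∸ suc k)) ≡ - (sign (suc k) * parabola M (fromℕℚ (suc k)))
      either true  = fromℤ-α m (suc k)
      either false = trans (fromℤ-α m (N ∸ suc k))
                       (cong₂ (λ s t → - (s * t)) (sign-reflect k<N) (parabola-reflect k<N))

    x-entry : ∀ i → x (3 ℕ.+ l) 5≤n i ≡ e₀ i + q i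
    x-entry zero = begin
      x (3 ℕ.+ l) 5≤n zero ≡⟨ /-as-* (xNumerator n′ 0) (6 ℕ.* N) ⟩
      fromℤ (xNumerator n′ 0) * c
        ≡⟨ cong (_* c) (trans (fromℤ-minus ((+ n′) ℤ.^ 2 ℤ.+ (+ 4) ℤ.* (+ n′)) (+ 12)) (cong (_- 12ℚ)
             (trans (fromℤ-+ ((+ n′) ℤ.^ 2) ((+ 4) ℤ.* (+ n′))) (cong₂ _+_ (fromℤ-square (+ n′)) (fromℤ-* (+ 4) (+ n′)))))) ⟩
      (fromℕℚ n′ * fromℕℚ n′ + 4ℚ * fromℕℚ n′ - 12ℚ) * c
        ≡⟨ cong (λ t → (t * t + 4ℚ * t - 12ℚ) * c) n≡ ⟩
      ((1ℚ + (M + M)) * (1ℚ + (M + M)) + 4ℚ * (1ℚ + (M + M)) - 12ℚ) * c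
        -- The numerator is 4M² + 12M - 7. The part 12M = 6N gives the 1 of `e₀`, and 4M² - 7 is the
        -- quadratic at 0.
        ≡⟨ ring M c ⟩
      c * (6ℚ * (M + M)) + X 0 ≡⟨ cong (_+ X 0) c*6N≡1 ⟩
      1ℚ + X 0 ∎
      where
      n′ = 3 ℕ.+ l
      ring : ∀ M c → ((1ℚ + (M + M)) * (1ℚ + (M + M)) + 4ℚ * (1ℚ + (M + M)) - 12ℚ) * c
                   ≡ c * (6ℚ * (M + M)) + - (1ℚ * (2ℚ * (M * M) - 6ℚ * ((M - 0ℚ) * (M - 0ℚ)) + 7ℚ)) * c
      ring = solve-∀ ℚ-ring
    x-entry (suc i) = begin
      x (3 ℕ.+ l) 5≤n (suc i) ≡⟨ /-as-* (xNumerator (3 ℕ.+ l) (suc (toℕ i))) (6 ℕ.* N) ⟩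
      fromℤ (xNumerator (3 ℕ.+ l) (suc (toℕ i))) * c
        ≡⟨ cong (_* c) (fromℤ-xNumerator (toℕ i) (ℕₚ.<⇒≤ (s≤s (toℕ<n i)))) ⟩
      X (suc (toℕ i)) ≡⟨ ring (X (suc (toℕ i))) ⟩
      0ℚ + X (suc (toℕ i)) ∎
      where
      ring : ∀ a → a ≡ 0ℚ + a
      ring = solve-∀ ℚ-ring

    y-entry : ∀ i → y (3 ℕ.+ l) 5≤n i ≡ - e₀ i + 6ℚ * c * w i
    y-entry i = trans (/-as-* (yNumerator (3 ℕ.+ l) (toℕ i)) N)
      (trans (cong (fromℤ (yNumerator (3 ℕ.+ l) (toℕ i)) *_) 1/N≡6c) (cases i))
      where
      ring : ∀ M c → (2ℚ - (1ℚ + (M + M))) * (6ℚ * c) ≡ - (c * (6ℚ * (M + M))) + 6ℚ * c * 1ℚ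
      ring = solve-∀ ℚ-ring
      ring′ : ∀ s c → s * (6ℚ * c) ≡ - 0ℚ + 6ℚ * c * s
      ring′ = solve-∀ ℚ-ring
      cases : ∀ i → fromℤ (yNumerator (3 ℕ.+ l) (toℕ i)) * (6ℚ * c) ≡ - e₀ i + 6ℚ * c * w i
      -- 2 - n = 1 - N: the -N gives `- e₀`, and the 1 is the first entry of `w`.
      cases zero = trans (cong (_* (6ℚ * c)) (trans (fromℤ-minus (+ 2) (+ (3 ℕ.+ l))) (cong (λ t → 2ℚ - t) n≡)))
                     (trans (ring M c) (cong (λ t → - t + 6ℚ * c * 1ℚ) c*6N≡1))
      cases (suc i) = trans (cong (_* (6ℚ * c)) (fromℤ-sign (suc (toℕ i)))) (ring′ (sign (suc (toℕ i))) c)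

    hasRank-L : HasRank (L (3 ℕ.+ l) 5≤n) (suc l ℕ.+ N)
    hasRank-L = Rank.hasRank-bordered (+ N / 2)
      (Circ (x (3 ℕ.+ l) 5≤n)) (Circ (y (3 ℕ.+ l) 5≤n)) corner
      (λ i j → trans (Circ-⊖ (x (3 ℕ.+ l) 5≤n) i j) (trans (x-entry (j ⊖ i)) (cong (_+ q (j ⊖ i)) (identity-⊖ i j))))
      (λ i j → trans (Circ-⊖ (y (3 ℕ.+ l) 5≤n) i j) (trans (y-entry (j ⊖ i))
        (cong₂ (λ s t → - s + 6ℚ * c * t) (identity-⊖ i j) (w-⊖ i j))))

  -- Parity and the conclusion.

  even⊎odd : ∀ n → (∃[ k ] n ≡ k ℕ.+ k) ⊎ (∃[ k ] n ≡ suc (k ℕ.+ k))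
  even⊎odd zero = inj₁ (0 , refl)
  even⊎odd (suc n) with even⊎odd n
  ... | inj₁ (k , n≡) = inj₂ (k , cong suc n≡)
  ... | inj₂ (k , n≡) = inj₁ (suc k , cong suc (trans n≡ (sym (ℕₚ.+-suc k k))))

open import Data.Nat.Base using (ℕ; suc; zero; s≤s; _≤_; _+_; _*_; _∸_)
open import Data.Nat.Divisibility using (_∣_; divides)
import Data.Nat.Properties as ℕₚ
open import Data.Product.Base using (_,_)
open import Data.Sum.Base using (inj₁; inj₂)
open import Relation.Binary.PropositionalEquality using (_≡_; trans; sym; cong; subst)
open import Relation.Nullary.Negation using (¬_; contradiction)
open BorderedCirculant using (even⊎odd; module Entries)

theorem4p23 : (n : ℕ) (5≤n : 5 ≤ n) → ¬ (2 ∣ n) → HasRank (L n 5≤n) (2 * n ∸ 3)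
theorem4p23 (suc zero) (s≤s ())
theorem4p23 (suc (suc zero)) (s≤s (s≤s ()))
theorem4p23 n@(suc (suc (suc l))) 5≤n 2∤n with even⊎odd n
... | inj₁ (m , n≡2m)   = contradiction (divides m (trans n≡2m (trans (cong (m +_) (sym (ℕₚ.+-identityʳ m))) (ℕₚ.*-comm 2 m)))) 2∤n
... | inj₂ (m , n≡1+2m) = subst (HasRank (L n 5≤n)) (sym rank≡) (Entries.hasRank-L m l (ℕₚ.suc-injective n≡1+2m) 5≤n)
  where
  rank≡ : 2 * (3 + l) ∸ 3 ≡ suc l + (2 + l)
  rank≡ = trans (cong (λ t → l + (3 + t)) (ℕₚ.+-identityʳ l)) (ℕₚ.+-suc l (2 + l))
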